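{- Let $\mathsf{M}$ be an elementary split matroid of rank $k$ and cardinality $n$. For each $r,h$ let $\lambda_{r,h}$ denote the number of stressed subsets of $\mathsf{M}$ with non-empty cover of rank $r$ and size $h$. Then the Tutte polynomial of $\mathsf{M}$ is given by \[ T_{\mathsf{M}}(x,y) = T_{\mathsf{U}_{k,n}}(x,y) - \sum_{r,h}\lambda_{r,h}\sum_{i=r+1}^{h}\sum_{j=0}^{k-r-1}\binom{h}{i}\binom{n-h}{j}\,\alpha_{r,k}^{i,j}(x,y),\] where \[\alpha_{r,k}^{i,j}(x,y)=\begin{cases}(x-1)^{k-i-j}\left(1-((x-1)(y-1))^{i-r}\right) & \text{if } i+j\le k,\\ (y-1)^{i+j-k}\left(1-((x-1)(y-1))^{k-r-j}\right) & \text{if } i+j>k.\end{cases}\]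
   Context: $\mathsf{U}_{k,n}$ is the uniform matroid of rank $k$ on $n$ elements. The Tutte polynomial of a matroid $\mathsf{M}$ on $E$ with rank function $\operatorname{rk}$ is $T_{\mathsf{M}}(x,y)=\sum_{A\subseteq E}(x-1)^{\operatorname{rk}(E)-\operatorname{rk}(A)}(y-1)^{|A|-\operatorname{rk}(A)}$. Let $\mathsf{M}$ be a matroid on $E$ of rank $k$. A subset $A\subseteq E$ is stressed if both $\mathsf{M}|_A$ and $\mathsf{M}/A$ are uniform. The cover of $A$ is $\operatorname{cover}(A)=\{S\subseteq E: |S|=k,\ |S\cap A|\ge \operatorname{rk}(A)+1\}$. Elementary split matroids: a matroid is connected if it is not a direct sum of two matroids with non-empty ground sets. For a connected matroid $\mathsf{M}$ on $E$, a flacet is a flat $F$ such that $\mathsf{M}|_F$ and $\mathsf{M}/F$ are connected; a flacet $F$ is a split flacet if $0<\operatorname{rk}(F)<|F|$ and $E\smallsetminus F$ contains at least one element that is not a coloop of $\mathsf{M}$. A connected split matroid is a connected matroid all of whose split flacets are stressed. A matroid is elementary split if it is either a connected split matroid or a direct sum of two uniform matroids. -}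

module Defs where

open import Algebra.Bundles using (CommutativeRing; Semiring)
import Algebra.Definitions.RawSemiring as RawSemiringDefinitions
import Algebra.Properties.AbelianGroup as AbelianGroupProperties
open import Algebra.Structures using (IsCommutativeRing)
open import Data.Bool using (if_then_else_)
import Data.Bool.Properties as Bool
open import Data.Fin using (Fin; toℕ)
open import Data.Fin.Subset hiding (_-_)
open import Data.Fin.Subset.Properties
import Data.Integer.Properties as ℤ
open import Data.List using (List; []; _∷_; map; foldr; filter; length; _++_)
open import Data.Nat as ℕ using (ℕ; zero; suc; _≤_; _<_; _∸_; _⊓_; _≤?_)
import Data.Nat.Properties as ℕ
open import Algebra.Properties.CommutativeSemigroup ℕ.+-commutativeSemigroup using (interchange)
open import Data.Product using (Σ-syntax; ∃-syntax; _×_; _,_; proj₁; proj₂)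
open import Data.Sum using (_⊎_; inj₁; inj₂; [_,_]′)
import Data.Vec.Base as Vec
import Data.Vec.Properties as Vec
open import Function using (_∘_; id)
open import Level using (0ℓ)
open import Relation.Binary using (Setoid)
open import Relation.Binary.PropositionalEquality using (_≡_; refl; sym; trans; cong; cong₂; subst; subst₂)
import Relation.Binary.Reasoning.Setoid as SetoidReasoning
open import Relation.Nullary using (¬_; Dec; yes; no; does)
open import Relation.Nullary.Decidable using (map′; _×-dec_; _→-dec_; decidable-stable; ¬?)
open import Relation.Unary using (Pred; Decidable)

private variable
  N : ℕ
  A B C D : Subset N

subsets : ∀ N → List (Subset N)
subsets zero    = Vec.[] ∷ []
subsets (suc N) = map (outside Vec.∷_) (subsets N) ++ map (inside Vec.∷_) (subsets N)

∣∪∣+∣∩∣ : ∀ (A B : Subset N) → ∣ A ∪ B ∣ ℕ.+ ∣ A ∩ B ∣ ≡ ∣ A ∣ ℕ.+ ∣ B ∣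
∣∪∣+∣∩∣ Vec.[] Vec.[] = refl
∣∪∣+∣∩∣ (outside Vec.∷ A) (outside Vec.∷ B) = ∣∪∣+∣∩∣ A B
∣∪∣+∣∩∣ (outside Vec.∷ A) (inside  Vec.∷ B) =
  trans (cong suc (∣∪∣+∣∩∣ A B)) (sym (ℕ.+-suc ∣ A ∣ ∣ B ∣))
∣∪∣+∣∩∣ (inside  Vec.∷ A) (outside Vec.∷ B) = cong suc (∣∪∣+∣∩∣ A B)
∣∪∣+∣∩∣ (inside  Vec.∷ A) (inside  Vec.∷ B) = cong suc
  (trans (ℕ.+-suc ∣ A ∪ B ∣ ∣ A ∩ B ∣)
  (trans (cong suc (∣∪∣+∣∩∣ A B)) (sym (ℕ.+-suc ∣ A ∣ ∣ B ∣))))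

∪-least : A ⊆ C → B ⊆ C → A ∪ B ⊆ C
∪-least {A = A} {B = B} A⊆C B⊆C x∈ = [ A⊆C , B⊆C ]′ (x∈p∪q⁻ A B x∈)

∪-mono-⊆ : A ⊆ C → B ⊆ D → A ∪ B ⊆ C ∪ D
∪-mono-⊆ {C = C} {D = D} A⊆C B⊆D =
  ∪-least (p⊆p∪q D ∘ A⊆C) (q⊆p∪q C D ∘ B⊆D)

∩-mono-⊆ : A ⊆ C → B ⊆ D → A ∩ B ⊆ C ∩ D
∩-mono-⊆ {A = A} {B = B} A⊆C B⊆D x∈ with x∈p∩q⁻ A B x∈
... | x∈A , x∈B = x∈p∩q⁺ (A⊆C x∈A , B⊆D x∈B)

∪-∪-distribʳ : ∀ (C A B : Subset N) → (A ∪ B) ∪ C ≡ (A ∪ C) ∪ (B ∪ C)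
∪-∪-distribʳ C A B = ⊆-antisym
  (∪-least (∪-mono-⊆ (p⊆p∪q C) (p⊆p∪q C)) (q⊆p∪q (A ∪ C) (B ∪ C) ∘ q⊆p∪q B C))
  (∪-least (∪-mono-⊆ (p⊆p∪q B) id) (∪-mono-⊆ (q⊆p∪q A B) id))

∩-∩-distribʳ : ∀ (C A B : Subset N) → (A ∩ B) ∩ C ≡ (A ∩ C) ∩ (B ∩ C)
∩-∩-distribʳ C A B = ⊆-antisym
  (λ x∈ → let x∈A∩B , x∈C = x∈p∩q⁻ (A ∩ B) C x∈; x∈A , x∈B = x∈p∩q⁻ A B x∈A∩B in
    x∈p∩q⁺ (x∈p∩q⁺ (x∈A , x∈C) , x∈p∩q⁺ (x∈B , x∈C)))
  (λ x∈ → let x∈A∩C , x∈B∩C = x∈p∩q⁻ (A ∩ C) (B ∩ C) x∈; x∈A , x∈C = x∈p∩q⁻ A C x∈A∩C in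
    x∈p∩q⁺ (x∈p∩q⁺ (x∈A , proj₁ (x∈p∩q⁻ B C x∈B∩C)) , x∈C))

allSubsets? : ∀ {p} {P : Pred (Subset N) p} → Decidable P → Dec (∀ A → P A)
allSubsets? P? with anySubset? (¬? ∘ P?)
... | yes (A , ¬PA) = no (λ ∀P → ¬PA (∀P A))
... | no ∄¬P        = yes (λ A → decidable-stable (P? A) (λ ¬PA → ∄¬P (A , ¬PA)))

-- The ground set is an arbitrary subset of an ambient finite set, so that
-- restrictions, contractions and direct summands live in the same type.
-- The values of rk outside the subsets of ground carry no meaning.
record Matroid (N : ℕ) : Set where
  field
    ground       : Subset N
    rk           : Subset N → ℕ
    rk-bounded   : A ⊆ ground → rk A ≤ ∣ A ∣
    rk-monotone  : A ⊆ B → B ⊆ ground → rk A ≤ rk B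
    rk-submodular : A ⊆ ground → B ⊆ ground →
                    rk (A ∪ B) ℕ.+ rk (A ∩ B) ≤ rk A ℕ.+ rk B

  rank : ℕ
  rank = rk ground

  size : ℕ
  size = ∣ ground ∣

  rank≤size : rank ≤ size
  rank≤size = rk-bounded id

open Matroid

infix 4 _≐_ _≐?_

-- Equality of matroids: rk is compared on subsets of the ground set only.
_≐_ : Matroid N → Matroid N → Set
M ≐ M′ = ground M ≡ ground M′ × (∀ A → A ⊆ ground M → rk M A ≡ rk M′ A)

_≐?_ : (M M′ : Matroid N) → Dec (M ≐ M′)
M ≐? M′ = Vec.≡-dec Bool._≟_ (ground M) (ground M′) ×-dec
  allSubsets? (λ A → (A ⊆? ground M) →-dec (rk M A ℕ.≟ rk M′ A))

⊓-submodular : ∀ k {a b u i} → i ≤ a → a ≤ u → i ≤ b → b ≤ u → u ℕ.+ i ≡ a ℕ.+ b →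
               (u ⊓ k) ℕ.+ (i ⊓ k) ≤ (a ⊓ k) ℕ.+ (b ⊓ k)
⊓-submodular k {a} {b} {u} {i} i≤a a≤u i≤b b≤u eq
  with ℕ.≤-total a k | ℕ.≤-total b k
... | inj₁ a≤k | inj₁ b≤k
  rewrite ℕ.m≤n⇒m⊓n≡m a≤k | ℕ.m≤n⇒m⊓n≡m b≤k =
  ℕ.≤-trans (ℕ.+-mono-≤ (ℕ.m⊓n≤m u k) (ℕ.m⊓n≤m i k)) (ℕ.≤-reflexive eq)
... | _ | inj₂ k≤b
  rewrite ℕ.m≥n⇒m⊓n≡n k≤b | ℕ.+-comm (a ⊓ k) k =
  ℕ.+-mono-≤ (ℕ.m⊓n≤n u k) (ℕ.⊓-monoˡ-≤ k i≤a)
... | inj₂ k≤a | _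
  rewrite ℕ.m≥n⇒m⊓n≡n k≤a =
  ℕ.+-mono-≤ (ℕ.m⊓n≤n u k) (ℕ.⊓-monoˡ-≤ k i≤b)

uniform : (E : Subset N) (k : ℕ) → k ≤ ∣ E ∣ → Matroid N
uniform E k k≤∣E∣ = record
  { ground        = E
  ; rk            = λ A → ∣ A ∣ ⊓ k
  ; rk-bounded    = λ {A} _ → ℕ.m⊓n≤m ∣ A ∣ k
  ; rk-monotone   = λ A⊆B _ → ℕ.⊓-monoˡ-≤ k (p⊆q⇒∣p∣≤∣q∣ A⊆B)
  ; rk-submodular = λ {A} {B} _ _ →
      ⊓-submodular k (∣p∩q∣≤∣p∣ A B) (∣p∣≤∣p∪q∣ A B) (∣p∩q∣≤∣q∣ A B) (∣q∣≤∣p∪q∣ A B) (∣∪∣+∣∩∣ A B)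
  }

U : (k n : ℕ) → k ≤ n → Matroid n
U k n k≤n = uniform ⊤ k (subst (k ≤_) (sym (∣⊤∣≡n n)) k≤n)

IsUniform : Matroid N → Set
IsUniform M = M ≐ uniform (ground M) (rank M) (rank≤size M)

isUniform? : (M : Matroid N) → Dec (IsUniform M)
isUniform? M = M ≐? uniform (ground M) (rank M) (rank≤size M)

restrict : (M : Matroid N) (A : Subset N) → A ⊆ ground M → Matroid N
restrict M A A⊆E = record
  { ground        = A
  ; rk            = rk M
  ; rk-bounded    = λ B⊆A → rk-bounded M (A⊆E ∘ B⊆A)
  ; rk-monotone   = λ B⊆C C⊆A → rk-monotone M B⊆C (A⊆E ∘ C⊆A)
  ; rk-submodular = λ B⊆A C⊆A → rk-submodular M (A⊆E ∘ B⊆A) (A⊆E ∘ C⊆A)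
  }

contract : (M : Matroid N) (A : Subset N) → A ⊆ ground M → Matroid N
contract {N} M A A⊆E = record
  { ground        = E ─ A
  ; rk            = r
  ; rk-bounded    = bounded
  ; rk-monotone   = λ {B} {C} B⊆C C⊆ →
      ℕ.∸-monoˡ-≤ (rk M A) (rk-monotone M (∪-mono-⊆ B⊆C id) (in-E C⊆))
  ; rk-submodular = submodular
  }
  where
  E = ground M

  r : Subset N → ℕ
  r B = rk M (B ∪ A) ∸ rk M A

  in-E : B ⊆ E ─ A → B ∪ A ⊆ E
  in-E B⊆ = ∪-least (p─q⊆p E A ∘ B⊆) A⊆E

  r-+ : B ⊆ E ─ A → r B ℕ.+ rk M A ≡ rk M (B ∪ A)
  r-+ {B = B} B⊆ = ℕ.m∸n+n≡m (rk-monotone M (q⊆p∪q B A) (in-E B⊆))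

  bounded : B ⊆ E ─ A → r B ≤ ∣ B ∣
  bounded {B = B} B⊆ = ℕ.+-cancelʳ-≤ (rk M A) (r B) ∣ B ∣ (begin
    r B ℕ.+ rk M A                   ≡⟨ r-+ B⊆ ⟩
    rk M (B ∪ A)                     ≤⟨ ℕ.m≤m+n _ _ ⟩
    rk M (B ∪ A) ℕ.+ rk M (B ∩ A)    ≤⟨ rk-submodular M B⊆E A⊆E ⟩
    rk M B ℕ.+ rk M A                ≤⟨ ℕ.+-monoˡ-≤ (rk M A) (rk-bounded M B⊆E) ⟩
    ∣ B ∣ ℕ.+ rk M A                 ∎)
    where
    open ℕ.≤-Reasoning
    B⊆E : B ⊆ E
    B⊆E = p─q⊆p E A ∘ B⊆

  submodular : B ⊆ E ─ A → C ⊆ E ─ A → r (B ∪ C) ℕ.+ r (B ∩ C) ≤ r B ℕ.+ r C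
  submodular {B = B} {C = C} B⊆ C⊆ =
    ℕ.+-cancelʳ-≤ (rk M A ℕ.+ rk M A) (r (B ∪ C) ℕ.+ r (B ∩ C)) (r B ℕ.+ r C) (begin
      (r (B ∪ C) ℕ.+ r (B ∩ C)) ℕ.+ (rk M A ℕ.+ rk M A)
        ≡⟨ interchange (r (B ∪ C)) (r (B ∩ C)) (rk M A) (rk M A) ⟩
      (r (B ∪ C) ℕ.+ rk M A) ℕ.+ (r (B ∩ C) ℕ.+ rk M A)
        ≡⟨ cong₂ ℕ._+_ (r-+ (∪-least B⊆ C⊆)) (r-+ (B⊆ ∘ p∩q⊆p B C)) ⟩
      rk M ((B ∪ C) ∪ A) ℕ.+ rk M ((B ∩ C) ∪ A)
        ≡⟨ cong₂ ℕ._+_ (cong (rk M) (∪-∪-distribʳ A B C))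
                       (cong (rk M) (∪-distribʳ-∩ A B C)) ⟩
      rk M ((B ∪ A) ∪ (C ∪ A)) ℕ.+ rk M ((B ∪ A) ∩ (C ∪ A))
        ≤⟨ rk-submodular M (in-E B⊆) (in-E C⊆) ⟩
      rk M (B ∪ A) ℕ.+ rk M (C ∪ A)
        ≡⟨ cong₂ ℕ._+_ (r-+ B⊆) (r-+ C⊆) ⟨
      (r B ℕ.+ rk M A) ℕ.+ (r C ℕ.+ rk M A)
        ≡⟨ interchange (r B) (rk M A) (r C) (rk M A) ⟩
      (r B ℕ.+ r C) ℕ.+ (rk M A ℕ.+ rk M A) ∎)
    where open ℕ.≤-Reasoning

directSum : (M₁ M₂ : Matroid N) → Empty (ground M₁ ∩ ground M₂) → Matroid N
directSum {N} M₁ M₂ disjoint = record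
  { ground        = E₁ ∪ E₂
  ; rk            = λ A → rk M₁ (A ∩ E₁) ℕ.+ rk M₂ (A ∩ E₂)
  ; rk-bounded    = λ {A} _ → bounded A
  ; rk-monotone   = λ {A} {B} A⊆B _ → ℕ.+-mono-≤
      (rk-monotone M₁ (∩-mono-⊆ A⊆B id) (p∩q⊆q B E₁))
      (rk-monotone M₂ (∩-mono-⊆ A⊆B id) (p∩q⊆q B E₂))
  ; rk-submodular = λ {A} {B} _ _ → submodular A B
  }
  where
  E₁ = ground M₁
  E₂ = ground M₂

  bounded : ∀ A → rk M₁ (A ∩ E₁) ℕ.+ rk M₂ (A ∩ E₂) ≤ ∣ A ∣
  bounded A = begin
    rk M₁ (A ∩ E₁) ℕ.+ rk M₂ (A ∩ E₂)
      ≤⟨ ℕ.+-mono-≤ (rk-bounded M₁ (p∩q⊆q A E₁)) (rk-bounded M₂ (p∩q⊆q A E₂)) ⟩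
    ∣ A ∩ E₁ ∣ ℕ.+ ∣ A ∩ E₂ ∣
      ≡⟨ ∣∪∣+∣∩∣ (A ∩ E₁) (A ∩ E₂) ⟨
    ∣ A ∩ E₁ ∪ A ∩ E₂ ∣ ℕ.+ ∣ (A ∩ E₁) ∩ (A ∩ E₂) ∣
      ≡⟨ cong (∣ A ∩ E₁ ∪ A ∩ E₂ ∣ ℕ.+_) (trans (cong ∣_∣ (Empty-unique noCommon)) (∣⊥∣≡0 N)) ⟩
    ∣ A ∩ E₁ ∪ A ∩ E₂ ∣ ℕ.+ 0
      ≡⟨ ℕ.+-identityʳ _ ⟩
    ∣ A ∩ E₁ ∪ A ∩ E₂ ∣
      ≤⟨ p⊆q⇒∣p∣≤∣q∣ (∪-least (p∩q⊆p A E₁) (p∩q⊆p A E₂)) ⟩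
    ∣ A ∣ ∎
    where
    open ℕ.≤-Reasoning
    noCommon : Empty ((A ∩ E₁) ∩ (A ∩ E₂))
    noCommon (x , x∈) = disjoint (x , ∩-mono-⊆ (p∩q⊆q A E₁) (p∩q⊆q A E₂) x∈)

  submodular : ∀ A B →
    (rk M₁ ((A ∪ B) ∩ E₁) ℕ.+ rk M₂ ((A ∪ B) ∩ E₂)) ℕ.+
    (rk M₁ ((A ∩ B) ∩ E₁) ℕ.+ rk M₂ ((A ∩ B) ∩ E₂)) ≤
    (rk M₁ (A ∩ E₁) ℕ.+ rk M₂ (A ∩ E₂)) ℕ.+ (rk M₁ (B ∩ E₁) ℕ.+ rk M₂ (B ∩ E₂))
  submodular A B = subst₂ _≤_
    (interchange (rk M₁ ((A ∪ B) ∩ E₁)) (rk M₁ ((A ∩ B) ∩ E₁))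
                 (rk M₂ ((A ∪ B) ∩ E₂)) (rk M₂ ((A ∩ B) ∩ E₂)))
    (interchange (rk M₁ (A ∩ E₁)) (rk M₁ (B ∩ E₁)) (rk M₂ (A ∩ E₂)) (rk M₂ (B ∩ E₂)))
    (ℕ.+-mono-≤ (part M₁) (part M₂))
    where
    part : (M′ : Matroid N) → let E′ = ground M′ in
      rk M′ ((A ∪ B) ∩ E′) ℕ.+ rk M′ ((A ∩ B) ∩ E′) ≤ rk M′ (A ∩ E′) ℕ.+ rk M′ (B ∩ E′)
    part M′ = subst (_≤ rk M′ (A ∩ E′) ℕ.+ rk M′ (B ∩ E′))
      (sym (cong₂ ℕ._+_ (cong (rk M′) (∩-distribʳ-∪ E′ A B))
                        (cong (rk M′) (∩-∩-distribʳ E′ A B))))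
      (rk-submodular M′ (p∩q⊆q A E′) (p∩q⊆q B E′))
      where E′ = ground M′

Stressed : Matroid N → Subset N → Set
Stressed M A = Σ[ A⊆E ∈ A ⊆ ground M ]
  (IsUniform (restrict M A A⊆E) × IsUniform (contract M A A⊆E))

stressed? : (M : Matroid N) → Decidable (Stressed M)
stressed? M A with A ⊆? ground M
... | no A⊈E  = no (A⊈E ∘ proj₁)
... | yes A⊆E = map′ (λ (u , v) → A⊆E , u , v) (λ (_ , u , v) → u , v)
  (isUniform? (restrict M A A⊆E) ×-dec isUniform? (contract M A A⊆E))

infix 4 _∈cover[_,_]

_∈cover[_,_] : Subset N → Matroid N → Subset N → Set
S ∈cover[ M , A ] = S ⊆ ground M × ∣ S ∣ ≡ rank M × suc (rk M A) ≤ ∣ S ∩ A ∣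

NonemptyCover : Matroid N → Subset N → Set
NonemptyCover M A = ∃[ S ] S ∈cover[ M , A ]

nonemptyCover? : (M : Matroid N) → Decidable (NonemptyCover M)
nonemptyCover? M A = anySubset? λ S →
  (S ⊆? ground M) ×-dec (∣ S ∣ ℕ.≟ rank M) ×-dec (suc (rk M A) ≤? ∣ S ∩ A ∣)

stressedCount : Matroid N → (r h : ℕ) → ℕ
stressedCount {N} M r h = length (filter counted? (subsets N))
  where
  counted? : Decidable (λ A → Stressed M A × NonemptyCover M A × rk M A ≡ r × ∣ A ∣ ≡ h)
  counted? A = stressed? M A ×-dec nonemptyCover? M A ×-dec (rk M A ℕ.≟ r) ×-dec (∣ A ∣ ℕ.≟ h)

-- The empty matroid counts as connected; in IsFlacet this only affects
-- F = ∅ and F = E, neither of which can be a split flacet.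
Connected : Matroid N → Set
Connected {N} M = ¬ (Σ[ M₁ ∈ Matroid N ] Σ[ M₂ ∈ Matroid N ]
  Σ[ disjoint ∈ Empty (ground M₁ ∩ ground M₂) ]
  (Nonempty (ground M₁) × Nonempty (ground M₂) × M ≐ directSum M₁ M₂ disjoint))

IsFlat : Matroid N → Subset N → Set
IsFlat M F = F ⊆ ground M ×
  (∀ e → e ∈ ground M → e ∉ F → rk M F < rk M (F ∪ ⁅ e ⁆))

IsColoop : Matroid N → Fin N → Set
IsColoop M e = e ∈ ground M × rk M (ground M ─ ⁅ e ⁆) < rank M

IsFlacet : Matroid N → Subset N → Set
IsFlacet M F = IsFlat M F × (Σ[ F⊆E ∈ F ⊆ ground M ]
  (Connected (restrict M F F⊆E) × Connected (contract M F F⊆E)))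

IsSplitFlacet : Matroid N → Subset N → Set
IsSplitFlacet M F = IsFlacet M F × 0 < rk M F × rk M F < ∣ F ∣ ×
  (∃[ e ] (e ∈ ground M ─ F × ¬ IsColoop M e))

ConnectedSplit : Matroid N → Set
ConnectedSplit M = Connected M × (∀ F → IsSplitFlacet M F → Stressed M F)

ElementarySplit : Matroid N → Set
ElementarySplit {N} M = ConnectedSplit M ⊎
  (Σ[ M₁ ∈ Matroid N ] Σ[ M₂ ∈ Matroid N ]
   Σ[ disjoint ∈ Empty (ground M₁ ∩ ground M₂) ]
   (IsUniform M₁ × IsUniform M₂ × M ≐ directSum M₁ M₂ disjoint))

-- A polynomial is the list of its coefficients, constant term first;
-- lists differing by trailing zeros are identified by _≋_.
module Polynomials {c ℓ} (R : CommutativeRing c ℓ) where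
  open CommutativeRing R renaming (Carrier to K; refl to ≈-refl; sym to ≈-sym; trans to ≈-trans)
  open AbelianGroupProperties +-abelianGroup using (ε⁻¹≈ε)
  open import Algebra.Properties.CommutativeSemigroup +-commutativeSemigroup
    using () renaming (interchange to +-interchange; x∙yz≈y∙xz to +-leftSwap)

  coeff : List K → ℕ → K
  coeff []      _       = 0#
  coeff (a ∷ p) zero    = a
  coeff (a ∷ p) (suc i) = coeff p i

  infix  4 _≋_
  infixl 6 _⊞_
  infixl 7 _⊠_

  record _≋_ (p q : List K) : Set ℓ where
    constructor coeffs
    field at : ∀ i → coeff p i ≈ coeff q i
  open _≋_

  _⊞_ : List K → List K → List K
  []      ⊞ q       = q
  (a ∷ p) ⊞ []      = a ∷ p
  (a ∷ p) ⊞ (b ∷ q) = a + b ∷ p ⊞ q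

  ⊟_ : List K → List K
  ⊟ p = map (-_) p

  scale : K → List K → List K
  scale a = map (a *_)

  _⊠_ : List K → List K → List K
  []      ⊠ q = []
  (a ∷ p) ⊠ q = scale a q ⊞ (0# ∷ p ⊠ q)

  private
    ≋-refl : ∀ {p} → p ≋ p
    ≋-refl = coeffs λ _ → ≈-refl

    ≋-sym : ∀ {p q} → p ≋ q → q ≋ p
    ≋-sym e = coeffs λ i → ≈-sym (at e i)

    ≋-trans : ∀ {p q r} → p ≋ q → q ≋ r → p ≋ r
    ≋-trans e f = coeffs λ i → ≈-trans (at e i) (at f i)

    ≋-setoid : Setoid c ℓ
    ≋-setoid = record
      { Carrier = List K ; _≈_ = _≋_
      ; isEquivalence = record { refl = ≋-refl ; sym = ≋-sym ; trans = ≋-trans } }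

    open SetoidReasoning ≋-setoid

    ∷-cong : ∀ {a b p q} → a ≈ b → p ≋ q → a ∷ p ≋ b ∷ q
    ∷-cong a≈b e = coeffs λ { zero → a≈b ; (suc i) → at e i }

    ∷-≋[] : ∀ {a p} → a ≈ 0# → p ≋ [] → a ∷ p ≋ []
    ∷-≋[] a≈0 e = coeffs λ { zero → a≈0 ; (suc i) → at e i }

    tail-≋ : ∀ {a b p q} → a ∷ p ≋ b ∷ q → p ≋ q
    tail-≋ e = coeffs λ i → at e (suc i)

    tail-≋[] : ∀ {a p} → a ∷ p ≋ [] → p ≋ []
    tail-≋[] e = coeffs λ i → at e (suc i)

    coeff-⊞ : ∀ p q i → coeff (p ⊞ q) i ≈ coeff p i + coeff q i
    coeff-⊞ []      q       i       = ≈-sym (+-identityˡ _)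
    coeff-⊞ (a ∷ p) []      i       = ≈-sym (+-identityʳ _)
    coeff-⊞ (a ∷ p) (b ∷ q) zero    = ≈-refl
    coeff-⊞ (a ∷ p) (b ∷ q) (suc i) = coeff-⊞ p q i

    coeff-⊟ : ∀ p i → coeff (⊟ p) i ≈ - coeff p i
    coeff-⊟ []      i       = ≈-sym ε⁻¹≈ε
    coeff-⊟ (a ∷ p) zero    = ≈-refl
    coeff-⊟ (a ∷ p) (suc i) = coeff-⊟ p i

    coeff-scale : ∀ a p i → coeff (scale a p) i ≈ a * coeff p i
    coeff-scale a []      i       = ≈-sym (zeroʳ a)
    coeff-scale a (b ∷ p) zero    = ≈-refl
    coeff-scale a (b ∷ p) (suc i) = coeff-scale a p i

    ⊞-cong : ∀ {p p′ q q′} → p ≋ p′ → q ≋ q′ → p ⊞ q ≋ p′ ⊞ q′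
    ⊞-cong {p} {p′} {q} {q′} e f = coeffs λ i → ≈-trans (coeff-⊞ p q i)
      (≈-trans (+-cong (at e i) (at f i)) (≈-sym (coeff-⊞ p′ q′ i)))

    ⊞-assoc : ∀ p q r → (p ⊞ q) ⊞ r ≋ p ⊞ (q ⊞ r)
    ⊞-assoc p q r = coeffs λ i →
      ≈-trans (coeff-⊞ (p ⊞ q) r i) (≈-trans (+-congʳ (coeff-⊞ p q i))
      (≈-trans (+-assoc _ _ _)
      (≈-sym (≈-trans (coeff-⊞ p (q ⊞ r) i) (+-congˡ (coeff-⊞ q r i))))))

    ⊞-comm : ∀ p q → p ⊞ q ≋ q ⊞ p
    ⊞-comm p q = coeffs λ i →
      ≈-trans (coeff-⊞ p q i) (≈-trans (+-comm _ _) (≈-sym (coeff-⊞ q p i)))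

    ⊞-identityʳ : ∀ p → p ⊞ [] ≋ p
    ⊞-identityʳ p = ⊞-comm p []

    ⊟-cong : ∀ {p q} → p ≋ q → ⊟ p ≋ ⊟ q
    ⊟-cong {p} {q} e = coeffs λ i →
      ≈-trans (coeff-⊟ p i) (≈-trans (-‿cong (at e i)) (≈-sym (coeff-⊟ q i)))

    ⊟-inverseˡ : ∀ p → ⊟ p ⊞ p ≋ []
    ⊟-inverseˡ p = coeffs λ i →
      ≈-trans (coeff-⊞ (⊟ p) p i) (≈-trans (+-congʳ (coeff-⊟ p i)) (-‿inverseˡ _))

    ⊟-inverseʳ : ∀ p → p ⊞ ⊟ p ≋ []
    ⊟-inverseʳ p = ≋-trans (⊞-comm p (⊟ p)) (⊟-inverseˡ p)

    ⊞-interchange : ∀ p q r s → (p ⊞ q) ⊞ (r ⊞ s) ≋ (p ⊞ r) ⊞ (q ⊞ s)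
    ⊞-interchange p q r s = coeffs λ i →
      ≈-trans (coeff-⊞ (p ⊞ q) (r ⊞ s) i)
      (≈-trans (+-cong (coeff-⊞ p q i) (coeff-⊞ r s i))
      (≈-trans (+-interchange _ _ _ _)
      (≈-sym (≈-trans (coeff-⊞ (p ⊞ r) (q ⊞ s) i) (+-cong (coeff-⊞ p r i) (coeff-⊞ q s i))))))

    ⊞-leftSwap : ∀ p q r → p ⊞ (q ⊞ r) ≋ q ⊞ (p ⊞ r)
    ⊞-leftSwap p q r = begin
      p ⊞ (q ⊞ r) ≈⟨ ⊞-assoc p q r ⟨
      (p ⊞ q) ⊞ r ≈⟨ ⊞-cong (⊞-comm p q) ≋-refl ⟩
      (q ⊞ p) ⊞ r ≈⟨ ⊞-assoc q p r ⟩
      q ⊞ (p ⊞ r) ∎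

    scale-cong : ∀ {a b p q} → a ≈ b → p ≋ q → scale a p ≋ scale b q
    scale-cong {a} {b} {p} {q} a≈b e = coeffs λ i →
      ≈-trans (coeff-scale a p i) (≈-trans (*-cong a≈b (at e i)) (≈-sym (coeff-scale b q i)))

    scale-0 : ∀ {a} p → a ≈ 0# → scale a p ≋ []
    scale-0 {a} p a≈0 = coeffs λ i →
      ≈-trans (coeff-scale a p i) (≈-trans (*-congʳ a≈0) (zeroˡ _))

    scale-1 : ∀ p → scale 1# p ≋ p
    scale-1 p = coeffs λ i → ≈-trans (coeff-scale 1# p i) (*-identityˡ _)

    scale-⊞ : ∀ a p q → scale a (p ⊞ q) ≋ scale a p ⊞ scale a q
    scale-⊞ a p q = coeffs λ i →
      ≈-trans (coeff-scale a (p ⊞ q) i) (≈-trans (*-congˡ (coeff-⊞ p q i))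
      (≈-trans (distribˡ _ _ _)
      (≈-sym (≈-trans (coeff-⊞ (scale a p) (scale a q) i)
        (+-cong (coeff-scale a p i) (coeff-scale a q i))))))

    scale-+ : ∀ a b p → scale (a + b) p ≋ scale a p ⊞ scale b p
    scale-+ a b p = coeffs λ i →
      ≈-trans (coeff-scale (a + b) p i) (≈-trans (distribʳ _ _ _)
      (≈-sym (≈-trans (coeff-⊞ (scale a p) (scale b p) i)
        (+-cong (coeff-scale a p i) (coeff-scale b p i)))))

    scale-* : ∀ a b p → scale (a * b) p ≋ scale a (scale b p)
    scale-* a b p = coeffs λ i →
      ≈-trans (coeff-scale (a * b) p i) (≈-trans (*-assoc _ _ _)
      (≈-sym (≈-trans (coeff-scale a (scale b p) i) (*-congˡ (coeff-scale b p i)))))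

    shift-⊞ : ∀ p q → 0# ∷ p ⊞ q ≋ (0# ∷ p) ⊞ (0# ∷ q)
    shift-⊞ p q = ∷-cong (≈-sym (+-identityˡ 0#)) ≋-refl

    ⊠-≋[]ˡ : ∀ {p} q → p ≋ [] → p ⊠ q ≋ []
    ⊠-≋[]ˡ {[]}    q e = ≋-refl
    ⊠-≋[]ˡ {a ∷ p} q e =
      ⊞-cong (scale-0 q (at e 0)) (∷-≋[] ≈-refl (⊠-≋[]ˡ q (tail-≋[] e)))

    ⊠-congʳ : ∀ {p p′} q → p ≋ p′ → p ⊠ q ≋ p′ ⊠ q
    ⊠-congʳ {[]}    {p′}     q e = ≋-sym (⊠-≋[]ˡ q (≋-sym e))
    ⊠-congʳ {a ∷ p} {[]}     q e = ⊠-≋[]ˡ q e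
    ⊠-congʳ {a ∷ p} {b ∷ p′} q e =
      ⊞-cong (scale-cong (at e 0) ≋-refl) (∷-cong ≈-refl (⊠-congʳ q (tail-≋ e)))

    ⊠-zeroʳ : ∀ p → p ⊠ [] ≋ []
    ⊠-zeroʳ []      = ≋-refl
    ⊠-zeroʳ (a ∷ p) = ∷-≋[] ≈-refl (⊠-zeroʳ p)

    ⊠-∷ : ∀ p b q → p ⊠ (b ∷ q) ≋ scale b p ⊞ (0# ∷ p ⊠ q)
    ⊠-∷ []      b q = ≋-sym (∷-≋[] ≈-refl ≋-refl)
    ⊠-∷ (a ∷ p) b q = ∷-cong (+-congʳ (*-comm a b)) (begin
      scale a q ⊞ p ⊠ (b ∷ q)                   ≈⟨ ⊞-cong ≋-refl (⊠-∷ p b q) ⟩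
      scale a q ⊞ (scale b p ⊞ (0# ∷ p ⊠ q))    ≈⟨ ⊞-leftSwap (scale a q) (scale b p) _ ⟩
      scale b p ⊞ (scale a q ⊞ (0# ∷ p ⊠ q))    ∎)

    ⊠-comm : ∀ p q → p ⊠ q ≋ q ⊠ p
    ⊠-comm []      q = ≋-sym (⊠-zeroʳ q)
    ⊠-comm (a ∷ p) q = begin
      scale a q ⊞ (0# ∷ p ⊠ q)   ≈⟨ ⊞-cong ≋-refl (∷-cong ≈-refl (⊠-comm p q)) ⟩
      scale a q ⊞ (0# ∷ q ⊠ p)   ≈⟨ ⊠-∷ q a p ⟨
      q ⊠ (a ∷ p)                ∎

    ⊠-cong : ∀ {p p′ q q′} → p ≋ p′ → q ≋ q′ → p ⊠ q ≋ p′ ⊠ q′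
    ⊠-cong {p} {p′} {q} {q′} e f = begin
      p ⊠ q    ≈⟨ ⊠-congʳ q e ⟩
      p′ ⊠ q   ≈⟨ ⊠-comm p′ q ⟩
      q ⊠ p′   ≈⟨ ⊠-congʳ p′ f ⟩
      q′ ⊠ p′  ≈⟨ ⊠-comm q′ p′ ⟩
      p′ ⊠ q′  ∎

    ⊠-distribʳ : ∀ r p q → (p ⊞ q) ⊠ r ≋ p ⊠ r ⊞ q ⊠ r
    ⊠-distribʳ r []      q       = ≋-refl
    ⊠-distribʳ r (a ∷ p) []      = ≋-sym (⊞-identityʳ _)
    ⊠-distribʳ r (a ∷ p) (b ∷ q) = begin
      scale (a + b) r ⊞ (0# ∷ (p ⊞ q) ⊠ r)
        ≈⟨ ⊞-cong (scale-+ a b r) (∷-cong ≈-refl (⊠-distribʳ r p q)) ⟩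
      (scale a r ⊞ scale b r) ⊞ (0# ∷ p ⊠ r ⊞ q ⊠ r)
        ≈⟨ ⊞-cong ≋-refl (shift-⊞ (p ⊠ r) (q ⊠ r)) ⟩
      (scale a r ⊞ scale b r) ⊞ ((0# ∷ p ⊠ r) ⊞ (0# ∷ q ⊠ r))
        ≈⟨ ⊞-interchange (scale a r) (scale b r) (0# ∷ p ⊠ r) (0# ∷ q ⊠ r) ⟩
      (a ∷ p) ⊠ r ⊞ (b ∷ q) ⊠ r ∎

    ⊠-distribˡ : ∀ r p q → r ⊠ (p ⊞ q) ≋ r ⊠ p ⊞ r ⊠ q
    ⊠-distribˡ r p q = begin
      r ⊠ (p ⊞ q)      ≈⟨ ⊠-comm r (p ⊞ q) ⟩
      (p ⊞ q) ⊠ r      ≈⟨ ⊠-distribʳ r p q ⟩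
      p ⊠ r ⊞ q ⊠ r    ≈⟨ ⊞-cong (⊠-comm p r) (⊠-comm q r) ⟩
      r ⊠ p ⊞ r ⊠ q    ∎

    scale-⊠ : ∀ a p q → scale a p ⊠ q ≋ scale a (p ⊠ q)
    scale-⊠ a []      q = ≋-refl
    scale-⊠ a (b ∷ p) q = begin
      scale (a * b) q ⊞ (0# ∷ scale a p ⊠ q)
        ≈⟨ ⊞-cong (scale-* a b q) (∷-cong (≈-sym (zeroʳ a)) (scale-⊠ a p q)) ⟩
      scale a (scale b q) ⊞ scale a (0# ∷ p ⊠ q)
        ≈⟨ scale-⊞ a (scale b q) (0# ∷ p ⊠ q) ⟨
      scale a ((b ∷ p) ⊠ q) ∎

    ⊠-assoc : ∀ p q r → (p ⊠ q) ⊠ r ≋ p ⊠ (q ⊠ r)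
    ⊠-assoc []      q r = ≋-refl
    ⊠-assoc (a ∷ p) q r = begin
      (scale a q ⊞ (0# ∷ p ⊠ q)) ⊠ r
        ≈⟨ ⊠-distribʳ r (scale a q) (0# ∷ p ⊠ q) ⟩
      scale a q ⊠ r ⊞ (scale 0# r ⊞ (0# ∷ (p ⊠ q) ⊠ r))
        ≈⟨ ⊞-cong (scale-⊠ a q r) (⊞-cong (scale-0 r ≈-refl) (∷-cong ≈-refl (⊠-assoc p q r))) ⟩
      (a ∷ p) ⊠ (q ⊠ r) ∎

    ⊠-identityˡ : ∀ p → (1# ∷ []) ⊠ p ≋ p
    ⊠-identityˡ p = begin
      scale 1# p ⊞ (0# ∷ [])  ≈⟨ ⊞-cong (scale-1 p) (∷-≋[] ≈-refl ≋-refl) ⟩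
      p ⊞ []                  ≈⟨ ⊞-identityʳ p ⟩
      p                       ∎

    ⊠-identityʳ : ∀ p → p ⊠ (1# ∷ []) ≋ p
    ⊠-identityʳ p = ≋-trans (⊠-comm p (1# ∷ [])) (⊠-identityˡ p)

    ⊞-⊠-isCommutativeRing : IsCommutativeRing _≋_ _⊞_ _⊠_ ⊟_ [] (1# ∷ [])
    ⊞-⊠-isCommutativeRing = record
      { isRing = record
        { +-isAbelianGroup = record
          { isGroup = record
            { isMonoid = record
              { isSemigroup = record
                { isMagma = record
                  { isEquivalence = Setoid.isEquivalence ≋-setoid ; ∙-cong = ⊞-cong }
                ; assoc = ⊞-assoc }
              ; identity = (λ _ → ≋-refl) , ⊞-identityʳ }
            ; inverse = ⊟-inverseˡ , ⊟-inverseʳ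
            ; ⁻¹-cong = ⊟-cong }
          ; comm = ⊞-comm }
        ; *-cong = ⊠-cong
        ; *-assoc = ⊠-assoc
        ; *-identity = ⊠-identityˡ , ⊠-identityʳ
        ; distrib = ⊠-distribˡ , ⊠-distribʳ }
      ; *-comm = ⊠-comm }

  polynomialRing : CommutativeRing c ℓ
  polynomialRing = record { isCommutativeRing = ⊞-⊠-isCommutativeRing }

  constant : K → List K
  constant a = a ∷ []

  indeterminate : List K
  indeterminate = 0# ∷ 1# ∷ []

ℤ[x] : CommutativeRing 0ℓ 0ℓ
ℤ[x] = Polynomials.polynomialRing ℤ.+-*-commutativeRing

ℤ[x,y] : CommutativeRing 0ℓ 0ℓ
ℤ[x,y] = Polynomials.polynomialRing ℤ[x]

x : CommutativeRing.Carrier ℤ[x,y]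
x = Polynomials.constant ℤ[x] (Polynomials.indeterminate ℤ.+-*-commutativeRing)

y : CommutativeRing.Carrier ℤ[x,y]
y = Polynomials.indeterminate ℤ[x]

-- The Tutte polynomial, in an arbitrary commutative ring R with chosen
-- elements x and y; the polynomial itself is the case R = ℤ[x,y].
-- The truncated subtractions in the exponents of T are exact because
-- rk A ≤ rank and rk A ≤ ∣ A ∣; those in α are exact for r < i and j < k ∸ r.

module Tutte {c ℓ} (R : CommutativeRing c ℓ) (x y : CommutativeRing.Carrier R) where
  open CommutativeRing R
  open RawSemiringDefinitions (Semiring.rawSemiring semiring) using (sum; _^_) renaming (_×_ to infixr 8 _·_) public

  -- The upper bound is excluded; the sum is empty when hi ≤ lo.
  rangeSum : (lo hi : ℕ) → (ℕ → Carrier) → Carrier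
  rangeSum lo hi f = sum {hi ∸ lo} (λ i → f (lo ℕ.+ toℕ i))

  syntax rangeSum lo hi (λ i → t) = ∑[ lo ≤ i < hi ] t

  T : Matroid N → Carrier
  T {N} M = foldr _+_ 0# (map term (filter (_⊆? ground M) (subsets N)))
    where
    term : Subset N → Carrier
    term A = (x - 1#) ^ (rank M ∸ rk M A) * (y - 1#) ^ (∣ A ∣ ∸ rk M A)

  α : (r k i j : ℕ) → Carrier
  α r k i j = if does (i ℕ.+ j ≤? k)
    then (x - 1#) ^ (k ∸ i ∸ j) * (1# - ((x - 1#) * (y - 1#)) ^ (i ∸ r))
    else (y - 1#) ^ (i ℕ.+ j ∸ k) * (1# - ((x - 1#) * (y - 1#)) ^ (k ∸ r ∸ j))

{-# OPTIONS --safe #-}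
module Submission where

open import Algebra.Bundles using (CommutativeRing)
open import Data.Bool as Bool using (if_then_else_; true; false)
open import Data.Empty using () renaming (⊥ to False; ⊥-elim to absurd)
open import Data.Fin as Fin using (Fin; toℕ; fromℕ<)
import Data.Fin.Properties as Fin
open import Data.Fin.Subset hiding (_-_)
open import Data.Fin.Subset.Induction using (⊂-wellFounded; ⊃-wellFounded)
open import Data.Fin.Subset.Properties
open import Data.List using (List; []; _∷_; map; foldr; filter; length; _++_)
open import Data.Nat as ℕ using (ℕ; zero; suc; _≤_; _<_; _∸_; _⊓_; _≤?_; _<?_; _≟_; z≤n; s≤s)
open import Data.Nat.Combinatorics using (_C_; nCn≡1; nCk≡nC[n∸k]; nCk+nC[k+1]≡[n+1]C[k+1])
import Data.Nat.Properties as ℕ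
open import Data.Nat.Tactic.RingSolver using (solve-∀)
open import Data.Product using (∃-syntax; _×_; _,_; proj₁; proj₂)
open import Data.Sum as Sum using (_⊎_; inj₁; inj₂; [_,_]′)
import Data.Vec.Base as Vec
open import Function using (_∘_; id)
open import Induction.WellFounded using (Acc; acc)
open import Relation.Binary.PropositionalEquality using (_≡_; _≢_; refl; sym; trans; cong; cong₂; subst; module ≡-Reasoning)
open import Relation.Nullary using (¬_; Dec; yes; no; does)
open import Relation.Nullary.Decidable using (_×-dec_; decidable-stable; dec-true; dec-false)
open import Relation.Unary using (Pred; Decidable)
open import Defs
open Matroid

-- Let A ⊆ E. Compare the terms of A in T_M and in T_{U_{k,n}}: they differ only if
-- rk A < min(|A|, k). In an elementary split matroid this happens precisely when some stressed F
-- satisfies |A ∩ F| > rk F and |A ─ F| < k - rk F; such an F is unique, rk A = rk F + |A ─ F|,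
-- and the two terms differ by α. Summing over A and grouping by F gives the formula, since
-- C(h,i) C(n-h,j) subsets A have |A ∩ F| = i and |A ─ F| = j.
--
-- Existence of F when M is connected: a minimal dependent D ⊆ A is connected, and a maximal H ⊇ D
-- with M|H connected and rk H < k is a split flacet, hence stressed. Uniqueness: by submodularity
-- A ∩ F ∩ F′ is dependent, so in both uniform restrictions it has full rank.

-- `Connected` is a negated statement about all pairs of matroids, and no decision procedure for it
-- is used. So a maximal connected `H` cannot simply be searched for: the existence of `F` is
-- derived by contradiction, through well-founded induction on subsets, and the double negation is
-- removed only at the end, because `Drops` is decidable and there are finitely many candidates `F`.
-- Connectedness enters these arguments through `Separation`, a single rank inequality at the ground
-- set. The condition on `F` does not mention covers: a counted `A` already forces the cover of `F`
-- to be non-empty, so counting only such `F` loses nothing. The algebra uses only the laws of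
-- commutative rings, hence it is carried out for arbitrary elements `x` and `y` and specialised to
-- `ℤ[x,y]` in the last line.

private variable
  N : ℕ
  A B D F : Subset N

-- Finite subsets and their sizes.

x∈p─q⇒x∉q : ∀ (p q : Subset N) {e} → e ∈ p ─ q → e ∉ q
x∈p─q⇒x∉q (_ Vec.∷ p) (_ Vec.∷ q) (Vec.there e∈) (Vec.there e∈q) = x∈p─q⇒x∉q p q e∈ e∈q

∪-∩-─ : ∀ (A F : Subset N) → A ⊆ (A ∩ F) ∪ (A ─ F)
∪-∩-─ A F {e} e∈A with e ∈? F
... | yes e∈F = x∈p∪q⁺ (inj₁ (x∈p∩q⁺ (e∈A , e∈F)))
... | no  e∉F = x∈p∪q⁺ (inj₂ (x∈p∧x∉q⇒x∈p─q e∈A e∉F))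

∣p∣≡∣p∩q∣+∣p─q∣ : ∀ (p q : Subset N) → ∣ p ∣ ≡ ∣ p ∩ q ∣ ℕ.+ ∣ p ─ q ∣
∣p∣≡∣p∩q∣+∣p─q∣ Vec.[]                Vec.[]                = refl
∣p∣≡∣p∩q∣+∣p─q∣ (outside Vec.∷ p) (outside Vec.∷ q) = ∣p∣≡∣p∩q∣+∣p─q∣ p q
∣p∣≡∣p∩q∣+∣p─q∣ (outside Vec.∷ p) (inside  Vec.∷ q) = ∣p∣≡∣p∩q∣+∣p─q∣ p q
∣p∣≡∣p∩q∣+∣p─q∣ (inside  Vec.∷ p) (inside  Vec.∷ q) = cong suc (∣p∣≡∣p∩q∣+∣p─q∣ p q)
∣p∣≡∣p∩q∣+∣p─q∣ (inside  Vec.∷ p) (outside Vec.∷ q) =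
  trans (cong suc (∣p∣≡∣p∩q∣+∣p─q∣ p q)) (sym (ℕ.+-suc _ _))

p⊆q⇒q∩p≡p : A ⊆ B → B ∩ A ≡ A
p⊆q⇒q∩p≡p {A = A} {B = B} A⊆B = ⊆-antisym (p∩q⊆q B A) (λ e∈ → x∈p∩q⁺ (A⊆B e∈ , e∈))

∣p∪q∣≤∣p∣+∣q∣ : ∀ (p q : Subset N) → ∣ p ∪ q ∣ ≤ ∣ p ∣ ℕ.+ ∣ q ∣
∣p∪q∣≤∣p∣+∣q∣ p q = ℕ.≤-trans (ℕ.m≤m+n _ _) (ℕ.≤-reflexive (∣∪∣+∣∩∣ p q))

⁅⁆⊆ : ∀ {e} → e ∈ A → ⁅ e ⁆ ⊆ A
⁅⁆⊆ {A = A} {e} e∈A f∈ = subst (_∈ A) (sym (x∈⁅y⁆⇒x≡y e f∈)) e∈A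

intermediate-size : ∀ (A B : Subset N) {k} → A ⊆ B → ∣ A ∣ ≤ k → k ≤ ∣ B ∣ →
                    ∃[ S ] (A ⊆ S × S ⊆ B × ∣ S ∣ ≡ k)
intermediate-size Vec.[] Vec.[] A⊆B z≤n z≤n = Vec.[] , id , id , refl
intermediate-size (outside Vec.∷ A) (outside Vec.∷ B) A⊆B lo hi =
  let S , A⊆S , S⊆B , eq = intermediate-size A B (drop-∷-⊆ A⊆B) lo hi in
  outside Vec.∷ S , s⊆s A⊆S , s⊆s S⊆B , eq
intermediate-size (inside Vec.∷ A) (outside Vec.∷ B) A⊆B lo hi with () ← A⊆B Vec.here
intermediate-size (inside Vec.∷ A) (inside Vec.∷ B) A⊆B (s≤s lo) (s≤s hi) =
  let S , A⊆S , S⊆B , eq = intermediate-size A B (drop-∷-⊆ A⊆B) lo hi in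
  inside Vec.∷ S , s⊆s A⊆S , s⊆s S⊆B , cong suc eq
intermediate-size (outside Vec.∷ A) (inside Vec.∷ B) {k} A⊆B lo hi with k ≤? ∣ B ∣
... | yes hi′ =
  let S , A⊆S , S⊆B , eq = intermediate-size A B (drop-∷-⊆ A⊆B) lo hi′ in
  outside Vec.∷ S , s⊆s A⊆S , out⊆ S⊆B , eq
-- The upper bound now forces `k ≡ suc ∣ B ∣`, so the whole larger set is the only choice.
... | no k≰∣B∣ = inside Vec.∷ B , out⊆ (drop-∷-⊆ A⊆B) , id , ℕ.≤-antisym (ℕ.≰⇒> k≰∣B∣) hi

-- Rank and separations

module _ (M : Matroid N) where

  -- Monotonicity absorbs the two inclusions, so applications need not rewrite their sets into a
  -- literal union and intersection.
  submodular : ∀ {X Y V W} → X ⊆ ground M → Y ⊆ ground M → V ⊆ X ∪ Y → W ⊆ X ∩ Y →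
               rk M V ℕ.+ rk M W ≤ rk M X ℕ.+ rk M Y
  submodular {X} {Y} X⊆ Y⊆ V⊆ W⊆ = ℕ.≤-trans
    (ℕ.+-mono-≤ (rk-monotone M V⊆ (∪-least X⊆ Y⊆)) (rk-monotone M W⊆ (X⊆ ∘ p∩q⊆p X Y)))
    (rk-submodular M X⊆ Y⊆)

  rk-⊥ : rk M ⊥ ≡ 0
  rk-⊥ = ℕ.n≤0⇒n≡0 (ℕ.≤-trans (rk-bounded M (⊥⊆ {p = ground M})) (ℕ.≤-reflexive (∣⊥∣≡0 N)))

  subadditive : ∀ {X Y V} → X ⊆ ground M → Y ⊆ ground M → V ⊆ X ∪ Y → rk M V ≤ rk M X ℕ.+ rk M Y
  subadditive X⊆ Y⊆ V⊆ = ℕ.≤-trans (ℕ.m≤m+n _ _) (submodular X⊆ Y⊆ V⊆ (⊥⊆ {p = _ ∩ _}))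

  Dependent : Subset N → Set
  Dependent D = rk M D < ∣ D ∣

  dependent-⊆ : D ⊆ B → B ⊆ ground M → Dependent D → Dependent B
  dependent-⊆ {D = D} {B = B} D⊆B B⊆E dep = begin-strict
    rk M B                   ≤⟨ subadditive (B⊆E ∘ D⊆B) (B⊆E ∘ p─q⊆p B D)
                                 (λ e∈ → ∪-mono-⊆ (p∩q⊆q B D) id (∪-∩-─ B D e∈)) ⟩
    rk M D ℕ.+ rk M (B ─ D)  ≤⟨ ℕ.+-monoʳ-≤ (rk M D) (rk-bounded M (B⊆E ∘ p─q⊆p B D)) ⟩
    rk M D ℕ.+ ∣ B ─ D ∣     <⟨ ℕ.+-monoˡ-< _ dep ⟩
    ∣ D ∣ ℕ.+ ∣ B ─ D ∣      ≡⟨ cong (λ S → ∣ S ∣ ℕ.+ ∣ B ─ D ∣) (p⊆q⇒q∩p≡p D⊆B) ⟨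
    ∣ B ∩ D ∣ ℕ.+ ∣ B ─ D ∣  ≡⟨ ∣p∣≡∣p∩q∣+∣p─q∣ B D ⟨
    ∣ B ∣                    ∎
    where open ℕ.≤-Reasoning

-- Positive data for a failure of connectedness. The one inequality `rk-sum` is enough: the reverse
-- is subadditivity, and additivity on all smaller sets follows by `rk-split`.
record Separation (M : Matroid N) : Set where
  field
    X Y      : Subset N
    X⊆       : X ⊆ ground M
    Y⊆       : Y ⊆ ground M
    covers   : ground M ⊆ X ∪ Y
    disjoint : ∀ {e} → e ∈ X → e ∉ Y
    X≠∅      : Nonempty X
    Y≠∅      : Nonempty Y
    rk-sum   : rk M X ℕ.+ rk M Y ≤ rank M

  -- Two uses of submodularity: `B ∪ X` and `Y` together cover the ground set and share at least
  -- `B ∩ Y`; then `B` is played against `X`. The excess is cancelled by `rk-sum`.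
  rk-split : ∀ {B} → B ⊆ ground M → rk M (B ∩ X) ℕ.+ rk M (B ∩ Y) ≤ rk M B
  rk-split {B} B⊆ = ℕ.+-cancelʳ-≤ (rk M X ℕ.+ rk M Y) _ _ (begin
    (b₁ ℕ.+ b₂) ℕ.+ (rk M X ℕ.+ rk M Y)          ≤⟨ ℕ.+-monoʳ-≤ (b₁ ℕ.+ b₂) rk-sum ⟩
    (b₁ ℕ.+ b₂) ℕ.+ rank M                       ≡⟨ regroup₁ b₁ b₂ (rank M) ⟩
    b₁ ℕ.+ (rank M ℕ.+ b₂)                       ≤⟨ ℕ.+-monoʳ-≤ b₁
      (submodular M (∪-least B⊆ X⊆) Y⊆
        (λ e∈ → ∪-mono-⊆ (q⊆p∪q B X) id (covers e∈)) (∩-mono-⊆ (p⊆p∪q X) id)) ⟩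
    b₁ ℕ.+ (rk M (B ∪ X) ℕ.+ rk M Y)             ≡⟨ regroup₂ b₁ (rk M (B ∪ X)) (rk M Y) ⟩
    (rk M (B ∪ X) ℕ.+ b₁) ℕ.+ rk M Y             ≤⟨ ℕ.+-monoˡ-≤ (rk M Y) (submodular M B⊆ X⊆ id id) ⟩
    (rk M B ℕ.+ rk M X) ℕ.+ rk M Y               ≡⟨ ℕ.+-assoc (rk M B) _ _ ⟩
    rk M B ℕ.+ (rk M X ℕ.+ rk M Y)               ∎)
    where
    open ℕ.≤-Reasoning
    b₁ = rk M (B ∩ X)
    b₂ = rk M (B ∩ Y)
    regroup₁ : ∀ a b c → (a ℕ.+ b) ℕ.+ c ≡ a ℕ.+ (c ℕ.+ b)
    regroup₁ = solve-∀
    regroup₂ : ∀ a b c → a ℕ.+ (b ℕ.+ c) ≡ (b ℕ.+ a) ℕ.+ c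
    regroup₂ = solve-∀

  splits : ∀ {B} → B ⊆ ground M → B ⊆ (B ∩ X) ∪ (B ∩ Y)
  splits {B} B⊆ e∈ = x∈p∪q⁺ (Sum.map (λ e∈X → x∈p∩q⁺ (e∈ , e∈X)) (λ e∈Y → x∈p∩q⁺ (e∈ , e∈Y))
    (x∈p∪q⁻ X Y (covers (B⊆ e∈))))

swap-separation : {M : Matroid N} → Separation M → Separation M
swap-separation {M = M} s = record
  { X = Y ; Y = X ; X⊆ = Y⊆ ; Y⊆ = X⊆
  ; covers = λ e∈ → x∈p∪q⁺ (Sum.swap (x∈p∪q⁻ X Y (covers e∈)))
  ; disjoint = λ e∈Y e∈X → disjoint e∈X e∈Y ; X≠∅ = Y≠∅ ; Y≠∅ = X≠∅
  ; rk-sum = subst (_≤ rank M) (ℕ.+-comm (rk M X) (rk M Y)) rk-sum }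
  where open Separation s

connected⇒inseparable : {M : Matroid N} → Connected M → ¬ Separation M
connected⇒inseparable {M = M} conn s = conn
  ( restrict M X X⊆ , restrict M Y Y⊆
  , (λ (e , e∈) → let e∈X , e∈Y = x∈p∩q⁻ X Y e∈ in disjoint e∈X e∈Y)
  , X≠∅ , Y≠∅
  , ⊆-antisym covers (∪-least X⊆ Y⊆)
  , λ A A⊆ → ℕ.≤-antisym
      (subadditive M (A⊆ ∘ p∩q⊆p A X) (A⊆ ∘ p∩q⊆p A Y) (splits A⊆)) (rk-split A⊆) )
  where open Separation s

inseparable⇒connected : {M : Matroid N} → ¬ Separation M → Connected M
inseparable⇒connected {M = M} insep (M₁ , M₂ , disj , ne₁ , ne₂ , E≡ , rk≡) = insep (record
  { X = E₁ ; Y = E₂ ; X⊆ = E₁⊆ ; Y⊆ = E₂⊆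
  ; covers = ⊆-reflexive E≡
  ; disjoint = λ e∈₁ e∈₂ → disj (_ , x∈p∩q⁺ (e∈₁ , e∈₂))
  ; X≠∅ = ne₁ ; Y≠∅ = ne₂
  ; rk-sum = ℕ.≤-reflexive (begin
      rk M E₁ ℕ.+ rk M E₂          ≡⟨ cong₂ ℕ._+_ (trans (rk≡ E₁ E₁⊆) left) (trans (rk≡ E₂ E₂⊆) right) ⟩
      rank M₁ ℕ.+ rank M₂          ≡⟨ cong₂ (λ X Y → rk M₁ X ℕ.+ rk M₂ Y)
                                        (p⊆q⇒q∩p≡p E₁⊆) (p⊆q⇒q∩p≡p E₂⊆) ⟨
      rk M₁ (ground M ∩ E₁) ℕ.+ rk M₂ (ground M ∩ E₂) ≡⟨ rk≡ (ground M) id ⟨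
      rank M                       ∎) })
  where
  open ≡-Reasoning
  E₁ = ground M₁
  E₂ = ground M₂
  E₁⊆ : E₁ ⊆ ground M
  E₁⊆ = ⊆-reflexive (sym E≡) ∘ p⊆p∪q E₂
  E₂⊆ : E₂ ⊆ ground M
  E₂⊆ = ⊆-reflexive (sym E≡) ∘ q⊆p∪q E₁ E₂
  left : rk M₁ (E₁ ∩ E₁) ℕ.+ rk M₂ (E₁ ∩ E₂) ≡ rank M₁
  left = trans (cong₂ (λ X Y → rk M₁ X ℕ.+ rk M₂ Y) (∩-idem E₁) (Empty-unique disj))
    (trans (cong (rank M₁ ℕ.+_) (rk-⊥ M₂)) (ℕ.+-identityʳ _))
  right : rk M₁ (E₂ ∩ E₁) ℕ.+ rk M₂ (E₂ ∩ E₂) ≡ rank M₂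
  right = trans (cong₂ (λ X Y → rk M₁ X ℕ.+ rk M₂ Y)
    (trans (∩-comm E₂ E₁) (Empty-unique disj)) (∩-idem E₂)) (cong (ℕ._+ rank M₂) (rk-⊥ M₁))

-- If `H` met both sides, `rk-split` would make its two traces a separation of the restriction to
-- `H`.
connected-⊆-separation : (M : Matroid N) {H K : Subset N} (H⊆ : H ⊆ ground M) (K⊆ : K ⊆ ground M) →
  Connected (restrict M H H⊆) → H ⊆ K → (s : Separation (restrict M K K⊆)) →
  H ⊆ Separation.X s ⊎ H ⊆ Separation.Y s
connected-⊆-separation M {H} {K} H⊆ K⊆ conn H⊆K s with nonempty? (H ∩ X) | nonempty? (H ∩ Y)
  where open Separation s
... | no ∅ | _ = inj₂ (λ e∈ → [ (λ e∈X → absurd (∅ (_ , x∈p∩q⁺ (e∈ , e∈X)))) , id ]′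
                          (x∈p∪q⁻ X Y (covers (H⊆K e∈))))
  where open Separation s
... | yes _ | no ∅ = inj₁ (λ e∈ → [ id , (λ e∈Y → absurd (∅ (_ , x∈p∩q⁺ (e∈ , e∈Y)))) ]′
                          (x∈p∪q⁻ X Y (covers (H⊆K e∈))))
  where open Separation s
... | yes neX | yes neY = absurd (connected⇒inseparable {M = restrict M H H⊆} conn (record
  { X = H ∩ X ; Y = H ∩ Y ; X⊆ = p∩q⊆p H X ; Y⊆ = p∩q⊆p H Y
  ; covers = splits H⊆K
  ; disjoint = λ e∈X e∈Y → disjoint (p∩q⊆q H X e∈X) (p∩q⊆q H Y e∈Y)
  ; X≠∅ = neX ; Y≠∅ = neY ; rk-sum = rk-split H⊆K }))
  where open Separation s

module _ {M : Matroid N} (conn : Connected M) {e f}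
         (e∈E : e ∈ ground M) (f∈E : f ∈ ground M) (f∉ : f ∉ ⁅ e ⁆) where

  -- A common source for `loopless` and `coloopless`: a loop contributes rank 0, and a coloop
  -- contributes at most the 1 that its deletion costs, so either would give this inequality. The
  -- element `f` keeps the other side of the separation non-empty.
  rk-singleton-connected : ¬ (rk M ⁅ e ⁆ ℕ.+ rk M (ground M ─ ⁅ e ⁆) ≤ rank M)
  rk-singleton-connected le = connected⇒inseparable {M = M} conn (record
    { X = ⁅ e ⁆ ; Y = ground M ─ ⁅ e ⁆ ; X⊆ = ⁅⁆⊆ e∈E ; Y⊆ = p─q⊆p (ground M) ⁅ e ⁆
    ; covers = λ e∈ → ∪-mono-⊆ (p∩q⊆q (ground M) ⁅ e ⁆) id (∪-∩-─ (ground M) ⁅ e ⁆ e∈)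
    ; disjoint = λ e∈ e∈′ → x∈p─q⇒x∉q (ground M) ⁅ e ⁆ e∈′ e∈
    ; X≠∅ = e , x∈⁅x⁆ e ; Y≠∅ = f , x∈p∧x∉q⇒x∈p─q f∈E f∉
    ; rk-sum = le })

  loopless : 0 < rk M ⁅ e ⁆
  loopless = ℕ.≰⇒> λ le → rk-singleton-connected
    (ℕ.+-mono-≤ le (rk-monotone M (p─q⊆p (ground M) ⁅ e ⁆) id))

  coloopless : ¬ IsColoop M e
  coloopless (_ , lt) = rk-singleton-connected (ℕ.≤-trans
    (ℕ.+-monoˡ-≤ _ (ℕ.≤-trans (rk-bounded M (⁅⁆⊆ e∈E)) (ℕ.≤-reflexive (∣⁅x⁆∣≡1 e)))) lt)

-- Stressed subsets

stressed-rk-⊆ : (M : Matroid N) → Stressed M F → B ⊆ F → rk M B ≡ ∣ B ∣ ⊓ rk M F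
stressed-rk-⊆ M (_ , (_ , unif) , _) B⊆F = unif _ B⊆F

∪-─-∪ : ∀ (B F : Subset N) → (B ─ F) ∪ F ≡ B ∪ F
∪-─-∪ B F = ⊆-antisym (∪-mono-⊆ (p─q⊆p B F) id)
  (∪-least (λ e∈ → ∪-comm-⊆ (∪-mono-⊆ (p∩q⊆q B F) id (∪-∩-─ B F e∈))) (q⊆p∪q (B ─ F) F))
  where
  ∪-comm-⊆ : ∀ {e} → e ∈ F ∪ (B ─ F) → e ∈ (B ─ F) ∪ F
  ∪-comm-⊆ = subst (_ ∈_) (∪-comm F (B ─ F))

-- Uniformity of the contraction, evaluated at `B ─ F`; monotonicity makes its truncated difference
-- exact, so `rk M F` can be added back.
stressed-rk-∪ : (M : Matroid N) → Stressed M F → B ⊆ ground M →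
                rk M (B ∪ F) ≡ rk M F ℕ.+ (∣ B ─ F ∣ ⊓ (rank M ∸ rk M F))
stressed-rk-∪ {F = F} {B = B} M (F⊆E , _ , _ , unif) B⊆E = begin
  rk M (B ∪ F)                                    ≡⟨ ℕ.m+[n∸m]≡n (rk-monotone M (q⊆p∪q B F) (∪-least B⊆E F⊆E)) ⟨
  rk M F ℕ.+ (rk M (B ∪ F) ∸ rk M F)              ≡⟨ cong (λ S → rk M F ℕ.+ (rk M S ∸ rk M F)) (∪-─-∪ B F) ⟨
  rk M F ℕ.+ (rk M ((B ─ F) ∪ F) ∸ rk M F)        ≡⟨ cong (rk M F ℕ.+_) (unif (B ─ F)
    (λ e∈ → x∈p∧x∉q⇒x∈p─q (B⊆E (p─q⊆p B F e∈)) (x∈p─q⇒x∉q B F e∈))) ⟩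
  rk M F ℕ.+ (∣ B ─ F ∣ ⊓ (rk M ((E ─ F) ∪ F) ∸ rk M F)) ≡⟨ cong (λ S → rk M F ℕ.+ (∣ B ─ F ∣ ⊓ (rk M S ∸ rk M F)))
    (trans (∪-─-∪ E F) (⊆-antisym (∪-least id F⊆E) (p⊆p∪q F))) ⟩
  rk M F ℕ.+ (∣ B ─ F ∣ ⊓ (rank M ∸ rk M F))      ∎
  where
  open ≡-Reasoning
  E = ground M

⊓<⇒> : ∀ m n → m ⊓ n < m → n < m
⊓<⇒> m n lt = ℕ.≰⇒> λ m≤n → ℕ.<-irrefl (ℕ.m≤n⇒m⊓n≡m m≤n) lt

-- The condition for A to be counted by α at F; then rk A = rk F + ∣ A ─ F ∣ < min(∣ A ∣, rank M).
Drops : Matroid N → Subset N → Subset N → Set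
Drops M A F = Stressed M F × rk M F < ∣ A ∩ F ∣ × ∣ A ─ F ∣ < rank M ∸ rk M F

drops? : (M : Matroid N) (A F : Subset N) → Dec (Drops M A F)
drops? M A F = stressed? M F ×-dec (rk M F <? ∣ A ∩ F ∣) ×-dec (∣ A ─ F ∣ <? rank M ∸ rk M F)

module _ (M : Matroid N) where

  dependent-in-stressed : Stressed M F → D ⊆ F → Dependent M D → rk M F < ∣ D ∣ × rk M D ≡ rk M F
  dependent-in-stressed {F = F} {D = D} st D⊆F dep =
    let rF<D = ⊓<⇒> ∣ D ∣ (rk M F) (subst (_< ∣ D ∣) (stressed-rk-⊆ M st D⊆F) dep) in
    rF<D , trans (stressed-rk-⊆ M st D⊆F) (ℕ.m≥n⇒m⊓n≡n (ℕ.<⇒≤ rF<D))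

  -- The dependent set `D` has the full rank of `F`, so submodularity of `A` and `F` gives
  -- `rk M (A ∪ F) ≤ rk M A`. If `A ─ F` had at least `rank M ∸ rk M F` elements, the uniform
  -- contraction would make `A ∪ F` spanning, against `rk M A < rank M`.
  dependent-∩⇒drops : A ⊆ ground M → rk M A < rank M → Stressed M F → D ⊆ A → D ⊆ F → Dependent M D →
                      Drops M A F
  dependent-∩⇒drops {A = A} {F = F} {D = D} A⊆E rA<k st D⊆A D⊆F dep =
    st , ℕ.<-≤-trans rF<D (p⊆q⇒∣p∣≤∣q∣ D⊆A∩F) , ℕ.≰⇒> λ ge → ℕ.<-irrefl refl (begin-strict
      rank M                                      ≤⟨ ℕ.m≤n+m∸n (rank M) (rk M F) ⟩
      rk M F ℕ.+ (rank M ∸ rk M F)                ≡⟨ cong (rk M F ℕ.+_) (ℕ.m≥n⇒m⊓n≡n ge) ⟨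
      rk M F ℕ.+ (∣ A ─ F ∣ ⊓ (rank M ∸ rk M F))  ≡⟨ stressed-rk-∪ M st A⊆E ⟨
      rk M (A ∪ F)                                ≤⟨ ℕ.+-cancelʳ-≤ (rk M F) _ _ A∪F≤A ⟩
      rk M A                                      <⟨ rA<k ⟩
      rank M                                      ∎)
    where
    open ℕ.≤-Reasoning
    F⊆E = proj₁ st
    D⊆A∩F : D ⊆ A ∩ F
    D⊆A∩F e∈ = x∈p∩q⁺ (D⊆A e∈ , D⊆F e∈)
    rF<D = proj₁ (dependent-in-stressed st D⊆F dep)
    A∪F≤A : rk M (A ∪ F) ℕ.+ rk M F ≤ rk M A ℕ.+ rk M F
    A∪F≤A = subst (λ r → rk M (A ∪ F) ℕ.+ r ≤ rk M A ℕ.+ rk M F)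
      (proj₂ (dependent-in-stressed st D⊆F dep)) (submodular M A⊆E F⊆E id D⊆A∩F)

  drops-rk-∪ : B ⊆ ground M → Stressed M F → ∣ B ─ F ∣ < rank M ∸ rk M F → rk M (B ∪ F) ≡ rk M F ℕ.+ ∣ B ─ F ∣
  drops-rk-∪ {F = F} B⊆E st lt = trans (stressed-rk-∪ M st B⊆E)
    (cong (rk M F ℕ.+_) (ℕ.m≤n⇒m⊓n≡m (ℕ.<⇒≤ lt)))

  -- `A ∩ F` already has the rank of `F`, so submodularity shows that joining `F` to `A` does not
  -- raise the rank; the uniform contraction gives the rank of `A ∪ F`.
  drops-rk : A ⊆ ground M → Drops M A F → rk M A ≡ rk M F ℕ.+ ∣ A ─ F ∣
  drops-rk {A = A} {F = F} A⊆E (st , i , j) = ℕ.≤-antisym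
    (ℕ.≤-trans (rk-monotone M (p⊆p∪q F) (∪-least A⊆E F⊆E)) (ℕ.≤-reflexive A∪F))
    (subst (_≤ rk M A) A∪F (ℕ.+-cancelʳ-≤ (rk M F) _ _
      (subst (λ r → rk M (A ∪ F) ℕ.+ r ≤ rk M A ℕ.+ rk M F)
        (trans (stressed-rk-⊆ M st (p∩q⊆q A F)) (ℕ.m≥n⇒m⊓n≡n (ℕ.<⇒≤ i)))
        (rk-submodular M A⊆E F⊆E))))
    where
    F⊆E = proj₁ st
    A∪F = drops-rk-∪ A⊆E st j

  -- Choose `suc (rk M F)` elements of `A ∩ F` and enlarge them to `rank M` elements. There is room
  -- because `j` makes `rank M ∸ rk M F` positive.
  drops⇒nonemptyCover : A ⊆ ground M → Drops M A F → NonemptyCover M F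
  drops⇒nonemptyCover {A = A} {F = F} A⊆E (st , i , j) =
    let B , _ , B⊆A∩F , ∣B∣ = intermediate-size ⊥ (A ∩ F) (⊥⊆ {p = A ∩ F})
                                (ℕ.≤-trans (ℕ.≤-reflexive (∣⊥∣≡0 N)) z≤n) i
        S , B⊆S , S⊆E , ∣S∣ = intermediate-size B (ground M) (A⊆E ∘ p∩q⊆p A F ∘ B⊆A∩F)
          (ℕ.≤-trans (ℕ.≤-reflexive ∣B∣) (ℕ.m∸n≢0⇒n<m (ℕ.>⇒≢ (ℕ.≤-trans (s≤s z≤n) j)))) (rank≤size M)
    in S , S⊆E , ∣S∣ , subst (_≤ ∣ S ∩ F ∣) ∣B∣
         (p⊆q⇒∣p∣≤∣q∣ (λ e∈ → x∈p∩q⁺ (B⊆S e∈ , p∩q⊆q A F (B⊆A∩F e∈))))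

  -- One inclusion suffices for uniqueness, since the two hypotheses can be exchanged.
  drops-⊆ : ∀ {F′} → A ⊆ ground M → Drops M A F → Drops M A F′ → F′ ⊆ F
  drops-⊆ {A = A} {F = F} {F′} A⊆E (st , i , j) (st′ , i′ , j′) {e} e∈F′ = decidable-stable (e ∈? F) λ e∉F →
    ℕ.<-irrefl (sym ∣F′─F∣≡0) (ℕ.≤-trans (ℕ.≤-reflexive (sym (∣⁅x⁆∣≡1 e)))
      (p⊆q⇒∣p∣≤∣q∣ (⁅⁆⊆ (x∈p∧x∉q⇒x∈p─q e∈F′ e∉F))))
    where
    open ℕ.≤-Reasoning
    F⊆E = proj₁ st
    F′⊆E = proj₁ st′
    P I : Subset N
    P = A ∩ F′
    I = P ∩ F
    P⊆E : P ⊆ ground M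
    P⊆E = A⊆E ∘ p∩q⊆p A F′
    -- `P ─ F` lies in `A ─ F` and inherits its bound, so the rank of `P ∪ F` is exactly
    -- `rk M F ℕ.+ ∣ P ─ F ∣`, without truncation.
    P─F : ∣ P ─ F ∣ < rank M ∸ rk M F
    P─F = ℕ.≤-<-trans (p⊆q⇒∣p∣≤∣q∣ (λ e∈ →
      x∈p∧x∉q⇒x∈p─q (p∩q⊆p A F′ (p─q⊆p P F e∈)) (x∈p─q⇒x∉q P F e∈))) j
    I-dependent : Dependent M I
    I-dependent = ℕ.+-cancelʳ-< ∣ P ─ F ∣ _ _ (ℕ.+-cancelʳ-< (rk M F) _ _ (begin-strict
      (rk M I ℕ.+ ∣ P ─ F ∣) ℕ.+ rk M F ≡⟨ rearrange (rk M I) ∣ P ─ F ∣ (rk M F) ⟩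
      (rk M F ℕ.+ ∣ P ─ F ∣) ℕ.+ rk M I ≡⟨ cong (ℕ._+ rk M I) (drops-rk-∪ P⊆E st P─F) ⟨
      rk M (P ∪ F) ℕ.+ rk M I          ≤⟨ rk-submodular M P⊆E F⊆E ⟩
      rk M P ℕ.+ rk M F                ≡⟨ cong (ℕ._+ rk M F) (stressed-rk-⊆ M st′ (p∩q⊆q A F′)) ⟩
      (∣ P ∣ ⊓ rk M F′) ℕ.+ rk M F     ≤⟨ ℕ.+-monoˡ-≤ (rk M F) (ℕ.m⊓n≤n ∣ P ∣ (rk M F′)) ⟩
      rk M F′ ℕ.+ rk M F               <⟨ ℕ.+-monoˡ-< (rk M F) i′ ⟩
      ∣ P ∣ ℕ.+ rk M F                 ≡⟨ cong (ℕ._+ rk M F) (∣p∣≡∣p∩q∣+∣p─q∣ P F) ⟩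
      (∣ I ∣ ℕ.+ ∣ P ─ F ∣) ℕ.+ rk M F ∎))
      where
      rearrange : ∀ a b c → (a ℕ.+ b) ℕ.+ c ≡ (c ℕ.+ b) ℕ.+ a
      rearrange = solve-∀
    I⊆F′ : I ⊆ F′
    I⊆F′ = p∩q⊆q A F′ ∘ p∩q⊆p P F
    rI≡rF′ : rk M I ≡ rk M F′
    rI≡rF′ = proj₂ (dependent-in-stressed st′ I⊆F′ I-dependent)
    -- `I` lies in both sets and has the rank of `F′`, so submodularity leaves no rank for `F′` to
    -- add to `F`. As `j` keeps `rank M ∸ rk M F` positive, the minimum can vanish only through
    -- `F′ ─ F`.
    ⊓≤0 : ∣ F′ ─ F ∣ ⊓ (rank M ∸ rk M F) ≤ 0
    ⊓≤0 = ℕ.+-cancelˡ-≤ (rk M F) _ _ (ℕ.+-cancelʳ-≤ (rk M F′) _ _ (begin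
      (rk M F ℕ.+ (∣ F′ ─ F ∣ ⊓ (rank M ∸ rk M F))) ℕ.+ rk M F′ ≡⟨ cong₂ ℕ._+_ (stressed-rk-∪ M st F′⊆E) rI≡rF′ ⟨
      rk M (F′ ∪ F) ℕ.+ rk M I                               ≤⟨ submodular M F′⊆E F⊆E id
                                                               (λ e∈ → x∈p∩q⁺ (I⊆F′ e∈ , p∩q⊆q P F e∈)) ⟩
      rk M F′ ℕ.+ rk M F                                     ≡⟨ rearrange (rk M F′) (rk M F) ⟩
      (rk M F ℕ.+ 0) ℕ.+ rk M F′                             ∎))
      where
      rearrange : ∀ a b → a ℕ.+ b ≡ (b ℕ.+ 0) ℕ.+ a
      rearrange = solve-∀
    ∣F′─F∣≡0 : ∣ F′ ─ F ∣ ≡ 0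
    ∣F′─F∣≡0 with ℕ.⊓-sel ∣ F′ ─ F ∣ (rank M ∸ rk M F)
    ... | inj₁ eq = trans (sym eq) (ℕ.n≤0⇒n≡0 ⊓≤0)
    ... | inj₂ eq = absurd (ℕ.<⇒≱ j (ℕ.≤-trans (subst (_≤ 0) eq ⊓≤0) z≤n))

  drops-unique : ∀ {F′} → A ⊆ ground M → Drops M A F → Drops M A F′ → F ≡ F′
  drops-unique A⊆E d d′ = ⊆-antisym (drops-⊆ A⊆E d′ d) (drops-⊆ A⊆E d d′)

-- Elementary split matroids

module _ (M : Matroid N) (conn : Connected M) (split : ∀ F → IsSplitFlacet M F → Stressed M F) where

  private
    E₀ : Subset N
    E₀ = ground M

  -- The conclusion is doubly negated because maximality of `H` is exploited only by contradiction.
  -- `connected-drops` needs no more, since it is itself refuting the absence of a suitable `F`.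
  stressed-superset : (D⊆E : D ⊆ E₀) → Dependent M D → Connected (restrict M D D⊆E) → rk M D < rank M →
                      ¬ ¬ (∃[ F ] (Stressed M F × D ⊆ F))
  stressed-superset {D = D} D⊆E dep D-conn D<k none = grow D (⊃-wellFounded D) D⊆E id D-conn D<k
    where
    open ℕ.≤-Reasoning
    -- Refutes `H` as a connected set of rank below `rank M` containing `D`. Proving this by
    -- induction along `_⊃_` replaces the choice of a maximal candidate.
    Absurd : Subset N → Set
    Absurd H = (H⊆E : H ⊆ E₀) → D ⊆ H → Connected (restrict M H H⊆E) → rk M H < rank M → False

    D≠∅ : Nonempty D
    D≠∅ = decidable-stable (nonempty? D) λ ∅ → ℕ.n≮0 (subst (rk M D <_) (trans (cong ∣_∣ (Empty-unique ∅)) (∣⊥∣≡0 N)) dep)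

    step : ∀ H → (∀ {H′} → H ⊂ H′ → Absurd H′) → Absurd H
    step H bigger H⊆E D⊆H H-conn H<k = none (H , split H split-flacet , D⊆H)
      where
      -- `h` inside `H` and `g` outside it provide the second element that `loopless` and
      -- `coloopless` require.
      h = proj₁ D≠∅
      h∈H = D⊆H (proj₂ D≠∅)

      E─H≠∅ : Nonempty (E₀ ─ H)
      E─H≠∅ = decidable-stable (nonempty? (E₀ ─ H)) λ ∅ → ℕ.<⇒≱ H<k (rk-monotone M
        (λ {e} e∈ → decidable-stable (e ∈? H) λ e∉ → ∅ (e , x∈p∧x∉q⇒x∈p─q e∈ e∉)) H⊆E)
      g = proj₁ E─H≠∅
      g∈E = p─q⊆p E₀ H (proj₂ E─H≠∅)
      g∉H = x∈p─q⇒x∉q E₀ H (proj₂ E─H≠∅)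

      h≢ : ∀ {e} → e ∉ H → h ∉ ⁅ e ⁆
      h≢ {e} e∉H h∈ = e∉H (subst (_∈ H) (x∈⁅y⁆⇒x≡y e h∈) h∈H)

      -- If adding `e` did not raise the rank, `H ∪ ⁅ e ⁆` would be a larger candidate. It is
      -- connected: in a separation `H` lies on one side, which leaves `e` alone on the other, and
      -- then `e` would have to be a loop.
      flat : ∀ e → e ∈ E₀ → e ∉ H → rk M H < rk M (H ∪ ⁅ e ⁆)
      flat e e∈E e∉H = ℕ.≰⇒> λ le → bigger
        (p⊆p∪q ⁅ e ⁆ , e , q⊆p∪q H ⁅ e ⁆ (x∈⁅x⁆ e) , e∉H)
        He⊆E (p⊆p∪q ⁅ e ⁆ ∘ D⊆H) (inseparable⇒connected (insep le)) (ℕ.≤-<-trans le H<k)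
        where
        He⊆E : H ∪ ⁅ e ⁆ ⊆ E₀
        He⊆E = ∪-least H⊆E (⁅⁆⊆ e∈E)
        no-sep : rk M (H ∪ ⁅ e ⁆) ≤ rk M H → (s : Separation (restrict M (H ∪ ⁅ e ⁆) He⊆E)) → H ⊆ Separation.X s → False
        no-sep le s H⊆X = ℕ.<⇒≱ (loopless {M = M} conn e∈E (H⊆E h∈H) (h≢ e∉H)) (ℕ.+-cancelˡ-≤ (rk M H) _ _ (begin
            rk M H ℕ.+ rk M ⁅ e ⁆    ≤⟨ ℕ.+-mono-≤ (rk-monotone M H⊆X (He⊆E ∘ X⊆))
                                          (rk-monotone M (⁅⁆⊆ e∈Y) (He⊆E ∘ Y⊆)) ⟩
            rk M X ℕ.+ rk M Y        ≤⟨ rk-sum ⟩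
            rk M (H ∪ ⁅ e ⁆)         ≤⟨ le ⟩
            rk M H                   ≡⟨ ℕ.+-identityʳ _ ⟨
            rk M H ℕ.+ 0             ∎))
          where
          open Separation s
          e∈Y : e ∈ Y
          e∈Y = [ (λ y∈H → absurd (disjoint (H⊆X y∈H) (proj₂ Y≠∅)))
                , (λ y∈ → subst (_∈ Y) (x∈⁅y⁆⇒x≡y e y∈) (proj₂ Y≠∅)) ]′
                (x∈p∪q⁻ H ⁅ e ⁆ (Y⊆ (proj₂ Y≠∅)))
        insep : rk M (H ∪ ⁅ e ⁆) ≤ rk M H → ¬ Separation (restrict M (H ∪ ⁅ e ⁆) He⊆E)
        insep le s = [ no-sep le s , no-sep le (swap-separation s) ]′
          (connected-⊆-separation M H⊆E He⊆E H-conn (p⊆p∪q ⁅ e ⁆) s)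

      -- Given a separation `X`, `Y` of the contraction, `X ∪ H` is a larger candidate: flatness of
      -- `H` gives `Y` positive rank over `H`, so `X ∪ H` is not spanning, and `no-sep` shows that
      -- it is connected.
      contraction-connected : Connected (contract M H H⊆E)
      contraction-connected = inseparable⇒connected {M = contract M H H⊆E} contradict
        where
        module _ (s : Separation (contract M H H⊆E)) where
          open Separation s
          ∉H : ∀ {e Z} → Z ⊆ E₀ ─ H → e ∈ Z → e ∉ H
          ∉H Z⊆ e∈ = x∈p─q⇒x∉q E₀ H (Z⊆ e∈)
          XH YH : Subset N
          XH = X ∪ H
          YH = Y ∪ H
          X⊆E : X ⊆ E₀
          X⊆E = p─q⊆p E₀ H ∘ X⊆
          Y⊆E : Y ⊆ E₀
          Y⊆E = p─q⊆p E₀ H ∘ Y⊆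
          XH⊆E : XH ⊆ E₀
          XH⊆E = ∪-least X⊆E H⊆E
          YH⊆E : YH ⊆ E₀
          YH⊆E = ∪-least Y⊆E H⊆E
          E⊆ : ∀ {e} → e ∈ E₀ → e ∈ H ⊎ (e ∈ X ⊎ e ∈ Y)
          E⊆ {e} e∈ with e ∈? H
          ... | yes e∈H = inj₁ e∈H
          ... | no  e∉H = inj₂ (x∈p∪q⁻ X Y (covers (x∈p∧x∉q⇒x∈p─q e∈ e∉H)))
          sum≤ : rk M XH ℕ.+ rk M YH ≤ rank M ℕ.+ rk M H
          sum≤ = begin
            rk M XH ℕ.+ rk M YH
              ≡⟨ cong₂ ℕ._+_ (ℕ.m∸n+n≡m (rk-monotone M (q⊆p∪q X H) XH⊆E)) (ℕ.m∸n+n≡m (rk-monotone M (q⊆p∪q Y H) YH⊆E)) ⟨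
            ((rk M XH ∸ rk M H) ℕ.+ rk M H) ℕ.+ ((rk M YH ∸ rk M H) ℕ.+ rk M H)
              ≡⟨ rearrange (rk M XH ∸ rk M H) (rk M YH ∸ rk M H) (rk M H) ⟩
            ((rk M XH ∸ rk M H) ℕ.+ (rk M YH ∸ rk M H)) ℕ.+ rk M H ℕ.+ rk M H
              ≤⟨ ℕ.+-monoˡ-≤ (rk M H) (ℕ.+-monoˡ-≤ (rk M H) rk-sum) ⟩
            (rk M ((E₀ ─ H) ∪ H) ∸ rk M H) ℕ.+ rk M H ℕ.+ rk M H
              ≡⟨ cong (ℕ._+ rk M H) (ℕ.m∸n+n≡m (rk-monotone M (q⊆p∪q (E₀ ─ H) H) (∪-least (p─q⊆p E₀ H) H⊆E))) ⟩
            rk M ((E₀ ─ H) ∪ H) ℕ.+ rk M H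
              ≤⟨ ℕ.+-monoˡ-≤ (rk M H) (rk-monotone M (∪-least (p─q⊆p E₀ H) H⊆E) id) ⟩
            rank M ℕ.+ rk M H ∎
            where
            rearrange : ∀ a b c → (a ℕ.+ c) ℕ.+ (b ℕ.+ c) ≡ (a ℕ.+ b) ℕ.+ c ℕ.+ c
            rearrange = solve-∀
          H<YH : rk M H < rk M YH
          H<YH = let e , e∈ = Y≠∅ in ℕ.<-≤-trans (flat e (Y⊆E e∈) (∉H Y⊆ e∈))
            (rk-monotone M (∪-least (q⊆p∪q Y H) (p⊆p∪q H ∘ ⁅⁆⊆ e∈)) YH⊆E)
          XH<k : rk M XH < rank M
          XH<k = ℕ.+-cancelʳ-< (rk M H) _ _ (ℕ.<-≤-trans (ℕ.+-monoʳ-< (rk M XH) H<YH) sum≤)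

          -- The side `Y′` avoids `H`, hence lies in `X`, so `Y` can be moved over to `X′` to
          -- separate `M` itself. Submodularity of `X′` and `Y ∪ H`, which share `H`, keeps the rank
          -- sum small enough.
          no-sep : (t : Separation (restrict M XH XH⊆E)) → H ⊆ Separation.X t → False
          no-sep t H⊆X′ = connected⇒inseparable {M = M} conn (record
            { X = X′ ∪ Y ; Y = Y′
            ; X⊆ = ∪-least X′⊆E Y⊆E ; Y⊆ = Y′⊆E
            ; covers = cover
            ; disjoint = λ e∈ e∈Y′ → [ (λ e∈X′ → T.disjoint e∈X′ e∈Y′)
                                     , (λ e∈Y → disjoint (Y′⊆X e∈Y′) e∈Y) ]′ (x∈p∪q⁻ X′ Y e∈)
            ; X≠∅ = proj₁ T.X≠∅ , p⊆p∪q Y (proj₂ T.X≠∅)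
            ; Y≠∅ = T.Y≠∅
            ; rk-sum = ℕ.+-cancelʳ-≤ (rk M H) _ _ (begin
                (rk M (X′ ∪ Y) ℕ.+ rk M Y′) ℕ.+ rk M H ≡⟨ rearrange (rk M (X′ ∪ Y)) (rk M Y′) (rk M H) ⟩
                (rk M (X′ ∪ Y) ℕ.+ rk M H) ℕ.+ rk M Y′ ≤⟨ ℕ.+-monoˡ-≤ (rk M Y′) (submodular M X′⊆E YH⊆E
                   (∪-mono-⊆ id (p⊆p∪q H)) (λ e∈ → x∈p∩q⁺ (H⊆X′ e∈ , q⊆p∪q Y H e∈))) ⟩
                (rk M X′ ℕ.+ rk M YH) ℕ.+ rk M Y′     ≡⟨ rearrange (rk M X′) (rk M YH) (rk M Y′) ⟩
                (rk M X′ ℕ.+ rk M Y′) ℕ.+ rk M YH     ≤⟨ ℕ.+-monoˡ-≤ (rk M YH) T.rk-sum ⟩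
                rk M XH ℕ.+ rk M YH                   ≤⟨ sum≤ ⟩
                rank M ℕ.+ rk M H                     ∎) })
            where
            module T = Separation t
            X′ = T.X
            Y′ = T.Y
            X′⊆E : X′ ⊆ E₀
            X′⊆E = XH⊆E ∘ T.X⊆
            Y′⊆E : Y′ ⊆ E₀
            Y′⊆E = XH⊆E ∘ T.Y⊆
            Y′⊆X : Y′ ⊆ X
            Y′⊆X e∈ = [ id , (λ e∈H → absurd (T.disjoint (H⊆X′ e∈H) e∈)) ]′ (x∈p∪q⁻ X H (T.Y⊆ e∈))
            cover : E₀ ⊆ (X′ ∪ Y) ∪ Y′
            cover e∈ = [ p⊆p∪q Y′ ∘ p⊆p∪q Y ∘ H⊆X′
                       , [ ∪-mono-⊆ (p⊆p∪q Y) id ∘ T.covers ∘ p⊆p∪q H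
                         , p⊆p∪q Y′ ∘ q⊆p∪q X′ Y ]′ ]′ (E⊆ e∈)
            rearrange : ∀ a b c → (a ℕ.+ b) ℕ.+ c ≡ (a ℕ.+ c) ℕ.+ b
            rearrange = solve-∀

          contradict : False
          contradict = bigger
            (q⊆p∪q X H , proj₁ X≠∅ , p⊆p∪q H (proj₂ X≠∅) , ∉H X⊆ (proj₂ X≠∅))
            XH⊆E (q⊆p∪q X H ∘ D⊆H)
            (inseparable⇒connected λ t → [ no-sep t , no-sep (swap-separation t) ]′
              (connected-⊆-separation M H⊆E XH⊆E H-conn (q⊆p∪q X H) t))
            XH<k

      split-flacet : IsSplitFlacet M H
      split-flacet = ((H⊆E , flat) , H⊆E , H-conn , contraction-connected)
        -- The remaining conditions: `h` is not a loop, `H` contains the dependent set `D`, and `g`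
        -- is an element outside `H` that is not a coloop.
        , ℕ.<-≤-trans (loopless {M = M} conn (H⊆E h∈H) g∈E (λ g∈ → g∉H (⁅⁆⊆ h∈H g∈))) (rk-monotone M (⁅⁆⊆ h∈H) H⊆E)
        , dependent-⊆ M D⊆H H⊆E dep
        , g , proj₂ E─H≠∅ , coloopless {M = M} conn g∈E (H⊆E h∈H) (h≢ g∉H)

    grow : ∀ H → Acc _⊃_ H → Absurd H
    grow H (acc rs) = step H λ {H′} H⊂H′ → grow H′ (rs H⊂H′)

  -- Assuming that no `F` works, induction along `_⊂_` shows that no subset of `A` is dependent,
  -- which contradicts `dep` at `A` itself.
  connected-drops : A ⊆ E₀ → Dependent M A → rk M A < rank M → ∃[ F ] Drops M A F
  connected-drops {A = A} A⊆E dep A<k = decidable-stable (anySubset? (drops? M A)) λ none →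
    shrink none A (⊂-wellFounded A) id dep
    where
    open ℕ.≤-Reasoning
    step : ¬ (∃[ F ] Drops M A F) → ∀ D → (∀ {D′} → D′ ⊂ D → D′ ⊆ A → ¬ Dependent M D′) → D ⊆ A → ¬ Dependent M D
    step none D smaller D⊆A D-dep = stressed-superset D⊆E D-dep
      (inseparable⇒connected insep) (ℕ.≤-<-trans (rk-monotone M D⊆A A⊆E) A<k)
      λ (F , st , D⊆F) → none (F , dependent-∩⇒drops M A⊆E A<k st D⊆A D⊆F D-dep)
      where
      D⊆E : D ⊆ E₀
      D⊆E = A⊆E ∘ D⊆A
      insep : ¬ Separation (restrict M D D⊆E)
      -- Both sides are proper subsets of `D`, hence independent by minimality, and adding their
      -- ranks would make `D` independent.
      insep s = ℕ.<⇒≱ D-dep (begin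
        ∣ D ∣                ≤⟨ p⊆q⇒∣p∣≤∣q∣ covers ⟩
        ∣ X ∪ Y ∣            ≤⟨ ∣p∪q∣≤∣p∣+∣q∣ X Y ⟩
        ∣ X ∣ ℕ.+ ∣ Y ∣      ≤⟨ ℕ.+-mono-≤
          (ℕ.≮⇒≥ (smaller (X⊆ , proj₁ Y≠∅ , Y⊆ (proj₂ Y≠∅) , λ e∈X → disjoint e∈X (proj₂ Y≠∅)) (D⊆A ∘ X⊆)))
          (ℕ.≮⇒≥ (smaller (Y⊆ , proj₁ X≠∅ , X⊆ (proj₂ X≠∅) , disjoint (proj₂ X≠∅)) (D⊆A ∘ Y⊆))) ⟩
        rk M X ℕ.+ rk M Y    ≤⟨ rk-sum ⟩
        rk M D               ∎)
        where open Separation s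
    shrink : ¬ (∃[ F ] Drops M A F) → ∀ D → Acc _⊂_ D → D ⊆ A → ¬ Dependent M D
    shrink none D (acc rs) = step none D λ {D′} D′⊂D → shrink none D′ (rs D′⊂D)

-- Direct sums of two uniform matroids.

module _ (M : Matroid N) (E₁ E₂ : Subset N) (k₁ k₂ : ℕ)
         (E≡ : ground M ≡ E₁ ∪ E₂) (disj : Empty (E₁ ∩ E₂)) (k₁≤ : k₁ ≤ ∣ E₁ ∣) (k₂≤ : k₂ ≤ ∣ E₂ ∣)
         (rk≡ : ∀ B → B ⊆ ground M → rk M B ≡ (∣ B ∩ E₁ ∣ ⊓ k₁) ℕ.+ (∣ B ∩ E₂ ∣ ⊓ k₂)) where

  private
    ⊆E : ∀ {e} → e ∈ E₁ ∪ E₂ → e ∈ ground M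
    ⊆E = ⊆-reflexive (sym E≡)

    E₁⊆E : E₁ ⊆ ground M
    E₁⊆E = ⊆E ∘ p⊆p∪q E₂

    E₂⊆E : E₂ ⊆ ground M
    E₂⊆E = ⊆E ∘ q⊆p∪q E₁ E₂

    E─E₁≡E₂ : ground M ─ E₁ ≡ E₂
    E─E₁≡E₂ = ⊆-antisym
      (λ e∈ → [ absurd ∘ x∈p─q⇒x∉q (ground M) E₁ e∈ , id ]′
        (x∈p∪q⁻ E₁ E₂ (⊆-reflexive E≡ (p─q⊆p (ground M) E₁ e∈))))
      (λ e∈₂ → x∈p∧x∉q⇒x∈p─q (E₂⊆E e∈₂) (λ e∈₁ → disj (_ , x∈p∩q⁺ (e∈₁ , e∈₂))))

    rk-⊆ : B ⊆ E₁ → rk M B ≡ ∣ B ∣ ⊓ k₁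
    rk-⊆ {B = B} B⊆ = trans (rk≡ B (E₁⊆E ∘ B⊆)) (trans
      (cong₂ (λ P Q → (∣ P ∣ ⊓ k₁) ℕ.+ (∣ Q ∣ ⊓ k₂)) (⊆-antisym (p∩q⊆p B E₁) (λ e∈ → x∈p∩q⁺ (e∈ , B⊆ e∈)))
        (Empty-unique (λ (e , e∈) → disj (e , ∩-mono-⊆ B⊆ id e∈))))
      (trans (cong (λ z → (∣ B ∣ ⊓ k₁) ℕ.+ (z ⊓ k₂)) (∣⊥∣≡0 N)) (ℕ.+-identityʳ _)))

    rk-E₁ : rk M E₁ ≡ k₁
    rk-E₁ = trans (rk-⊆ id) (ℕ.m≥n⇒m⊓n≡n k₁≤)

    rk-∪ : B ⊆ E₂ → rk M (B ∪ E₁) ≡ k₁ ℕ.+ (∣ B ∣ ⊓ k₂)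
    rk-∪ {B = B} B⊆ = trans (rk≡ (B ∪ E₁) (∪-least (E₂⊆E ∘ B⊆) E₁⊆E)) (trans
      (cong₂ (λ P Q → (∣ P ∣ ⊓ k₁) ℕ.+ (∣ Q ∣ ⊓ k₂)) (p⊆q⇒q∩p≡p (q⊆p∪q B E₁))
        (⊆-antisym
          (λ e∈ → let e∈B∪E₁ , e∈₂ = x∈p∩q⁻ (B ∪ E₁) E₂ e∈ in
            [ id , (λ e∈₁ → absurd (disj (_ , x∈p∩q⁺ (e∈₁ , e∈₂)))) ]′ (x∈p∪q⁻ B E₁ e∈B∪E₁))
          (λ e∈ → x∈p∩q⁺ (p⊆p∪q E₁ e∈ , B⊆ e∈))))
      (cong (ℕ._+ (∣ B ∣ ⊓ k₂)) (ℕ.m≥n⇒m⊓n≡n k₁≤)))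

    rk-∪-E₂ : rk M (E₂ ∪ E₁) ≡ k₁ ℕ.+ k₂
    rk-∪-E₂ = trans (rk-∪ id) (cong (k₁ ℕ.+_) (ℕ.m≥n⇒m⊓n≡n k₂≤))

    rank-sum : rank M ≡ k₁ ℕ.+ k₂
    rank-sum = trans (cong (rk M) (trans E≡ (∪-comm E₁ E₂))) rk-∪-E₂

    rk-contract : B ⊆ E₂ → rk M (B ∪ E₁) ∸ rk M E₁ ≡ ∣ B ∣ ⊓ (rk M (E₂ ∪ E₁) ∸ rk M E₁)
    rk-contract {B = B} B⊆ = begin
      rk M (B ∪ E₁) ∸ rk M E₁                ≡⟨ cong₂ _∸_ (rk-∪ B⊆) rk-E₁ ⟩
      k₁ ℕ.+ (∣ B ∣ ⊓ k₂) ∸ k₁               ≡⟨ ℕ.m+n∸m≡n k₁ _ ⟩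
      ∣ B ∣ ⊓ k₂                             ≡⟨ cong (∣ B ∣ ⊓_) (ℕ.m+n∸m≡n k₁ k₂) ⟨
      ∣ B ∣ ⊓ (k₁ ℕ.+ k₂ ∸ k₁)               ≡⟨ cong (∣ B ∣ ⊓_) (cong₂ _∸_ rk-∪-E₂ rk-E₁) ⟨
      ∣ B ∣ ⊓ (rk M (E₂ ∪ E₁) ∸ rk M E₁)     ∎
      where open ≡-Reasoning

  -- Restricting to one summand returns it and contracting it returns the other; both are uniform.
  summand-stressed : Stressed M E₁
  summand-stressed = E₁⊆E
    , (refl , λ B B⊆ → trans (rk-⊆ B⊆) (cong (∣ B ∣ ⊓_) (sym rk-E₁)))
    , (refl , λ B B⊆ → trans (rk-contract (⊆-reflexive E─E₁≡E₂ ∘ B⊆))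
        (cong (λ Q → ∣ B ∣ ⊓ (rk M (Q ∪ E₁) ∸ rk M E₁)) (sym E─E₁≡E₂)))

  summand-drops : A ⊆ ground M → k₁ < ∣ A ∩ E₁ ∣ → ∣ A ∩ E₂ ∣ < k₂ → Drops M A E₁
  summand-drops {A = A} A⊆E i j = summand-stressed , subst (_< ∣ A ∩ E₁ ∣) (sym rk-E₁) i
    , subst (∣ A ─ E₁ ∣ <_) (sym (trans (cong₂ _∸_ rank-sum rk-E₁) (ℕ.m+n∸m≡n k₁ k₂)))
        (ℕ.≤-<-trans (p⊆q⇒∣p∣≤∣q∣ (λ e∈ → x∈p∩q⁺ (p─q⊆p A E₁ e∈ , ⊆-reflexive E─E₁≡E₂
          (x∈p∧x∉q⇒x∈p─q (A⊆E (p─q⊆p A E₁ e∈)) (x∈p─q⇒x∉q A E₁ e∈))))) j)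

module _ (M M₁ M₂ : Matroid N) (disj : Empty (ground M₁ ∩ ground M₂))
         (unif₁ : IsUniform M₁) (unif₂ : IsUniform M₂) (M≐ : M ≐ directSum M₁ M₂ disj) where

  private
    E₁ E₂ : Subset N
    E₁ = ground M₁
    E₂ = ground M₂
    k₁ = rank M₁
    k₂ = rank M₂

    rk≡ : ∀ B → B ⊆ ground M → rk M B ≡ (∣ B ∩ E₁ ∣ ⊓ k₁) ℕ.+ (∣ B ∩ E₂ ∣ ⊓ k₂)
    rk≡ B B⊆ = trans (proj₂ M≐ B B⊆)
      (cong₂ ℕ._+_ (proj₂ unif₁ _ (p∩q⊆q B E₁)) (proj₂ unif₂ _ (p∩q⊆q B E₂)))

    rank≤ : rank M ≤ k₁ ℕ.+ k₂
    rank≤ = ℕ.≤-trans (ℕ.≤-reflexive (rk≡ (ground M) id))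
      (ℕ.+-mono-≤ (ℕ.m⊓n≤n ∣ ground M ∩ E₁ ∣ k₁) (ℕ.m⊓n≤n ∣ ground M ∩ E₂ ∣ k₂))

  -- With `a₁`, `a₂` the sizes of the two traces, the rank is `(a₁ ⊓ k₁) ℕ.+ (a₂ ⊓ k₂)`. Dependence
  -- forces one trace to exceed its rank, and rank deficiency then forces the other to stay strictly
  -- below its own. The overfull summand is `F`.
  directSum-drops : A ⊆ ground M → Dependent M A → rk M A < rank M → ∃[ F ] Drops M A F
  directSum-drops {A = A} A⊆E dep A<k with ∣ A ∩ E₁ ∣ ≤? k₁
  -- The overfull trace is the second one, so the lemma is applied with the summands exchanged.
  ... | yes a₁≤k₁ = E₂ , summand-drops M E₂ E₁ k₂ k₁ (trans (proj₁ M≐) (∪-comm E₁ E₂))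
      (disj ∘ subst Nonempty (∩-comm E₂ E₁)) (rank≤size M₂) (rank≤size M₁)
      (λ B B⊆ → trans (rk≡ B B⊆) (ℕ.+-comm (∣ B ∩ E₁ ∣ ⊓ k₁) _)) A⊆E k₂<a₂
      (ℕ.+-cancelʳ-< k₂ _ _ (begin-strict
        a₁ ℕ.+ k₂                ≡⟨ cong₂ ℕ._+_ (ℕ.m≤n⇒m⊓n≡m a₁≤k₁) (ℕ.m≥n⇒m⊓n≡n (ℕ.<⇒≤ k₂<a₂)) ⟨
        (a₁ ⊓ k₁) ℕ.+ (a₂ ⊓ k₂)  ≡⟨ rk≡ A A⊆E ⟨
        rk M A                   <⟨ A<k ⟩
        rank M                   ≤⟨ rank≤ ⟩
        k₁ ℕ.+ k₂                ∎))
    where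
    open ℕ.≤-Reasoning
    a₁ = ∣ A ∩ E₁ ∣
    a₂ = ∣ A ∩ E₂ ∣
    A⊆∪ : A ⊆ (A ∩ E₁) ∪ (A ∩ E₂)
    A⊆∪ e∈ = x∈p∪q⁺ (Sum.map (λ e∈₁ → x∈p∩q⁺ (e∈ , e∈₁)) (λ e∈₂ → x∈p∩q⁺ (e∈ , e∈₂))
      (x∈p∪q⁻ E₁ E₂ (⊆-reflexive (proj₁ M≐) (A⊆E e∈))))
    k₂<a₂ : k₂ < a₂
    k₂<a₂ = ⊓<⇒> a₂ k₂ (ℕ.+-cancelˡ-< a₁ _ _ (begin-strict
      a₁ ℕ.+ (a₂ ⊓ k₂)         ≡⟨ cong (ℕ._+ (a₂ ⊓ k₂)) (ℕ.m≤n⇒m⊓n≡m a₁≤k₁) ⟨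
      (a₁ ⊓ k₁) ℕ.+ (a₂ ⊓ k₂)  ≡⟨ rk≡ A A⊆E ⟨
      rk M A                   <⟨ dep ⟩
      ∣ A ∣                    ≤⟨ p⊆q⇒∣p∣≤∣q∣ A⊆∪ ⟩
      ∣ A ∩ E₁ ∪ A ∩ E₂ ∣      ≤⟨ ∣p∪q∣≤∣p∣+∣q∣ (A ∩ E₁) (A ∩ E₂) ⟩
      a₁ ℕ.+ a₂                ∎))
  ... | no a₁≰k₁ = E₁ , summand-drops M E₁ E₂ k₁ k₂ (proj₁ M≐) disj (rank≤size M₁) (rank≤size M₂) rk≡ A⊆E k₁<a₁
      (⊓<⇒> k₂ a₂ (ℕ.+-cancelˡ-< k₁ _ _ (begin-strict
        k₁ ℕ.+ (k₂ ⊓ a₂)         ≡⟨ cong₂ ℕ._+_ (sym (ℕ.m≥n⇒m⊓n≡n (ℕ.<⇒≤ k₁<a₁))) (ℕ.⊓-comm k₂ a₂) ⟩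
        (a₁ ⊓ k₁) ℕ.+ (a₂ ⊓ k₂)  ≡⟨ rk≡ A A⊆E ⟨
        rk M A                   <⟨ A<k ⟩
        rank M                   ≤⟨ rank≤ ⟩
        k₁ ℕ.+ k₂                ∎)))
    where
    open ℕ.≤-Reasoning
    a₁ = ∣ A ∩ E₁ ∣
    a₂ = ∣ A ∩ E₂ ∣
    k₁<a₁ = ℕ.≰⇒> a₁≰k₁

elementarySplit-drops : (M : Matroid N) → ElementarySplit M → A ⊆ ground M → Dependent M A → rk M A < rank M →
                        ∃[ F ] Drops M A F
elementarySplit-drops M (inj₁ (conn , split)) = connected-drops M conn split
elementarySplit-drops M (inj₂ (M₁ , M₂ , disj , unif₁ , unif₂ , M≐)) = directSum-drops M M₁ M₂ disj unif₁ unif₂ M≐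

no-drop⇒uniform-rk : (M : Matroid N) → ElementarySplit M → A ⊆ ground M → ¬ (∃[ F ] Drops M A F) →
                     rk M A ≡ ∣ A ∣ ⊓ rank M
no-drop⇒uniform-rk {A = A} M es A⊆E none with rk M A <? ∣ A ∣ | rk M A <? rank M
... | yes dep | yes lt = absurd (none (elementarySplit-drops M es A⊆E dep lt))
... | yes dep | no nlt = trans (ℕ.≤-antisym (rk-monotone M A⊆E id) (ℕ.≮⇒≥ nlt))
  (sym (ℕ.m≥n⇒m⊓n≡n (ℕ.≤-trans (ℕ.≮⇒≥ nlt) (rk-bounded M A⊆E))))
... | no ndep | _ = trans (ℕ.≤-antisym (rk-bounded M A⊆E) (ℕ.≮⇒≥ ndep))
  (sym (ℕ.m≤n⇒m⊓n≡m (ℕ.≤-trans (ℕ.≮⇒≥ ndep) (rk-monotone M A⊆E id))))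

-- Sums over subsets, and the Tutte polynomial

module TutteExpansion {c ℓ} (R : CommutativeRing c ℓ) (x y : CommutativeRing.Carrier R) where
  open CommutativeRing R hiding (zero) renaming (refl to ≈-refl; sym to ≈-sym; trans to ≈-trans)
  open Tutte R x y
  open import Algebra.Properties.CommutativeMonoid.Sum +-commutativeMonoid
    using (sum-cong-≋; sum-replicate-zero; ∑-distrib-+)
  open import Algebra.Properties.Monoid.Mult +-monoid using (×-congˡ; ×-homo-+)
  open import Algebra.Properties.Semiring.Exp semiring using (^-homo-*)
  open import Algebra.Properties.CommutativeSemiring.Exp commutativeSemiring using (^-distrib-*)
  open import Algebra.Properties.CommutativeSemigroup +-commutativeSemigroup using (interchange)
  open import Relation.Binary.Reasoning.Setoid setoid

  -- An indicator factor. It turns filters and index ranges into sums over a fixed domain, whose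
  -- order can then be exchanged.
  guard : ∀ {p} {P : Set p} → Dec P → Carrier → Carrier
  guard d a = if does d then a else 0#

  guard-true : ∀ {p} {P : Set p} (d : Dec P) {a} → P → guard d a ≡ a
  guard-true d {a} p = cong (if_then a else 0#) (dec-true d p)

  guard-false : ∀ {p} {P : Set p} (d : Dec P) {a} → ¬ P → guard d a ≡ 0#
  guard-false d {a} ¬p = cong (if_then a else 0#) (dec-false d ¬p)

  guard-cong : ∀ {p} {P : Set p} (d : Dec P) {a b} → (P → a ≈ b) → guard d a ≈ guard d b
  guard-cong (yes p) e = e p
  guard-cong (no ¬p) e = ≈-refl

  guard-⇔ : ∀ {p q} {P : Set p} {Q : Set q} (d : Dec P) (d′ : Dec Q) {a} →
            (P → Q) → (Q → P) → guard d a ≡ guard d′ a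
  guard-⇔ (yes p) d′ f g = sym (guard-true d′ (f p))
  guard-⇔ (no ¬p) d′ f g = sym (guard-false d′ (¬p ∘ g))

  guard-0 : ∀ {p} {P : Set p} (d : Dec P) → guard d 0# ≡ 0#
  guard-0 (yes _) = refl
  guard-0 (no _)  = refl

  guard-≈0 : ∀ {p} {P : Set p} (d : Dec P) {a} → (P → a ≈ 0#) → guard d a ≈ 0#
  guard-≈0 (yes p) e = e p
  guard-≈0 (no _)  e = ≈-refl

  guard-+ : ∀ {p} {P : Set p} (d : Dec P) a b → guard d (a + b) ≈ guard d a + guard d b
  guard-+ (yes _) a b = ≈-refl
  guard-+ (no _)  a b = ≈-sym (+-identityˡ 0#)

  guard-× : ∀ {p q} {P : Set p} {Q : Set q} (d : Dec P) (d′ : Dec Q) a → guard (d ×-dec d′) a ≡ guard d (guard d′ a)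
  guard-× (yes _) d′ a = refl
  guard-× (no _)  d′ a = refl

  module _ {b} {B : Set b} where

    listSum : List B → (B → Carrier) → Carrier
    listSum l f = foldr _+_ 0# (map f l)

    listSum-cong : ∀ l {f g} → (∀ b → f b ≈ g b) → listSum l f ≈ listSum l g
    listSum-cong []      e = ≈-refl
    listSum-cong (b ∷ l) e = +-cong (e b) (listSum-cong l e)

    listSum-0 : ∀ l → listSum l (λ _ → 0#) ≈ 0#
    listSum-0 []      = ≈-refl
    listSum-0 (b ∷ l) = ≈-trans (+-identityˡ _) (listSum-0 l)

    listSum-+ : ∀ l f g → listSum l (λ b → f b + g b) ≈ listSum l f + listSum l g
    listSum-+ []      f g = ≈-sym (+-identityˡ 0#)
    listSum-+ (b ∷ l) f g = ≈-trans (+-congˡ (listSum-+ l f g)) (interchange _ _ _ _)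

    listSum-++ : ∀ l l′ f → listSum (l ++ l′) f ≈ listSum l f + listSum l′ f
    listSum-++ []      l′ f = ≈-sym (+-identityˡ _)
    listSum-++ (b ∷ l) l′ f = ≈-trans (+-congˡ (listSum-++ l l′ f)) (≈-sym (+-assoc _ _ _))

    listSum-homo : (h : Carrier → Carrier) → h 0# ≈ 0# → (∀ a b → h (a + b) ≈ h a + h b) →
                   ∀ l f → h (listSum l f) ≈ listSum l (h ∘ f)
    listSum-homo h h0 h+ []      f = h0
    listSum-homo h h0 h+ (b ∷ l) f = ≈-trans (h+ _ _) (+-congˡ (listSum-homo h h0 h+ l f))

    listSum-filter : ∀ {p} {P : Pred B p} (P? : Decidable P) l f →
                     listSum (filter P? l) f ≈ listSum l (λ b → guard (P? b) (f b))
    listSum-filter P? []      f = ≈-refl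
    listSum-filter P? (b ∷ l) f with does (P? b)
    ... | true  = +-congˡ (listSum-filter P? l f)
    ... | false = ≈-trans (listSum-filter P? l f) (≈-sym (+-identityˡ _))

    length-filter-· : ∀ {p} {P : Pred B p} (P? : Decidable P) l v →
                      length (filter P? l) · v ≈ listSum l (λ b → guard (P? b) v)
    length-filter-· P? []      v = ≈-refl
    length-filter-· P? (b ∷ l) v with does (P? b)
    ... | true  = +-congˡ (length-filter-· P? l v)
    ... | false = ≈-trans (length-filter-· P? l v) (≈-sym (+-identityˡ _))

    listSum-sum : ∀ l {n} (f : B → Fin n → Carrier) →
                  listSum l (λ b → sum (f b)) ≈ sum (λ i → listSum l (λ b → f b i))
    listSum-sum []      {n} f = ≈-sym (sum-replicate-zero n)
    listSum-sum (b ∷ l) f = ≈-trans (+-congˡ (listSum-sum l f))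
      (≈-sym (∑-distrib-+ (f b) (λ i → listSum l (λ b → f b i))))

  listSum-map : ∀ {a b} {A : Set a} {B : Set b} (h : A → B) l f → listSum (map h l) f ≡ listSum l (f ∘ h)
  listSum-map h []      f = refl
  listSum-map h (a ∷ l) f = cong (f (h a) +_) (listSum-map h l f)

  listSum-swap : ∀ {a b} {A : Set a} {B : Set b} (l : List A) (l′ : List B) (f : A → B → Carrier) →
                 listSum l (λ a → listSum l′ (f a)) ≈ listSum l′ (λ b → listSum l (λ a → f a b))
  listSum-swap []      l′ f = ≈-sym (listSum-0 l′)
  listSum-swap (a ∷ l) l′ f = ≈-trans (+-congˡ (listSum-swap l l′ f)) (≈-sym (listSum-+ l′ _ _))

  sum-guard : ∀ {p} {P : Set p} (d : Dec P) {n} (f : Fin n → Carrier) → guard d (sum f) ≈ sum (guard d ∘ f)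
  sum-guard (yes _) f = ≈-refl
  sum-guard (no _) {n} f = ≈-sym (sum-replicate-zero n)

  sum-single : ∀ {n} (f : Fin n → Carrier) i → (∀ j → j ≢ i → f j ≈ 0#) → sum f ≈ f i
  sum-single {suc n} f Fin.zero    e = ≈-trans (+-congˡ (≈-trans (sum-cong-≋ (λ j → e (Fin.suc j) λ ())) (sum-replicate-zero n)))
    (+-identityʳ _)
  sum-single {suc n} f (Fin.suc i) e = ≈-trans (+-cong (e Fin.zero λ ())
    (sum-single (f ∘ Fin.suc) i λ j j≢i → e (Fin.suc j) (j≢i ∘ Fin.suc-injective))) (+-identityˡ _)

  rangeSum-cong : ∀ lo hi {f g : ℕ → Carrier} → (∀ i → f i ≈ g i) → rangeSum lo hi f ≈ rangeSum lo hi g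
  rangeSum-cong lo hi e = sum-cong-≋ {hi ∸ lo} λ i → e (lo ℕ.+ toℕ i)

  rangeSum-δ : ∀ lo hi m (g : ℕ → Carrier) →
               rangeSum lo hi (λ i → guard (m ≟ i) (g i)) ≈ guard (lo ≤? m) (guard (m <? hi) (g m))
  rangeSum-δ lo hi m g with (lo ≤? m) ×-dec (m <? hi)
  ... | yes (lo≤m , m<hi) = begin
    rangeSum lo hi (λ i → guard (m ≟ i) (g i))            ≈⟨ sum-single _ i₀ (λ j j≢ → reflexive
       (guard-false (m ≟ (lo ℕ.+ toℕ j))
       λ m≡ → j≢ (Fin.toℕ-injective (ℕ.+-cancelˡ-≡ lo _ _ (trans (sym m≡) (sym lo+i₀)))))) ⟩
    guard (m ≟ lo ℕ.+ toℕ i₀) (g (lo ℕ.+ toℕ i₀))         ≡⟨ cong (λ i → guard (m ≟ i) (g i)) lo+i₀ ⟩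
    guard (m ≟ m) (g m)                                   ≡⟨ guard-true (m ≟ m) refl ⟩
    g m                                                   ≡⟨ guard-true (m <? hi) m<hi ⟨
    guard (m <? hi) (g m)                                 ≡⟨ guard-true (lo ≤? m) lo≤m ⟨
    guard (lo ≤? m) (guard (m <? hi) (g m))               ∎
    where
    i₀ : Fin (hi ∸ lo)
    i₀ = fromℕ< (ℕ.∸-monoˡ-< m<hi lo≤m)
    lo+i₀ : lo ℕ.+ toℕ i₀ ≡ m
    lo+i₀ = trans (cong (lo ℕ.+_) (Fin.toℕ-fromℕ< _)) (ℕ.m+[n∸m]≡n lo≤m)
  ... | no out = begin
    rangeSum lo hi (λ i → guard (m ≟ i) (g i))            ≈⟨ sum-cong-≋ (λ j → reflexive (guard-false (m ≟ (lo ℕ.+ toℕ j))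
      λ m≡ → out (subst (λ m → lo ≤ m × m < hi) (sym m≡) (in-range j)))) ⟩
    sum {hi ∸ lo} (λ _ → 0#)                              ≈⟨ sum-replicate-zero (hi ∸ lo) ⟩
    0#                                                    ≡⟨ outside-range ⟨
    guard (lo ≤? m) (guard (m <? hi) (g m))               ∎
    where
    in-range : (j : Fin (hi ∸ lo)) → lo ≤ lo ℕ.+ toℕ j × lo ℕ.+ toℕ j < hi
    -- An element of `Fin (hi ∸ lo)` shows that the difference is non-zero, hence that the
    -- subtraction is exact.
    in-range j = ℕ.m≤m+n lo (toℕ j) , (ℕ.<-≤-trans (ℕ.+-monoʳ-< lo (Fin.toℕ<n j))
      (ℕ.≤-reflexive (ℕ.m+[n∸m]≡n (ℕ.<⇒≤ (ℕ.m∸n≢0⇒n<m {hi} {lo} (ℕ.>⇒≢ (ℕ.≤-<-trans z≤n (Fin.toℕ<n j))))))))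
    outside-range : guard (lo ≤? m) (guard (m <? hi) (g m)) ≡ 0#
    outside-range = trans (sym (guard-× (lo ≤? m) (m <? hi) (g m)))
      (guard-false ((lo ≤? m) ×-dec (m <? hi)) out)

  rangeSum-δ₂ : ∀ lo hi lo′ hi′ m m′ (g : ℕ → ℕ → Carrier) →
    rangeSum lo hi (λ i → rangeSum lo′ hi′ (λ j → guard (m ≟ i) (guard (m′ ≟ j) (g i j)))) ≈
    guard (lo ≤? m) (guard (m <? hi) (guard (lo′ ≤? m′) (guard (m′ <? hi′) (g m m′))))
  rangeSum-δ₂ lo hi lo′ hi′ m m′ g = ≈-trans
    (rangeSum-cong lo hi λ i → ≈-trans
      (≈-sym (sum-guard (m ≟ i) {hi′ ∸ lo′} λ j → guard (m′ ≟ (lo′ ℕ.+ toℕ j)) (g i (lo′ ℕ.+ toℕ j))))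
      (guard-cong (m ≟ i) λ _ → rangeSum-δ lo′ hi′ m′ (g i)))
    (rangeSum-δ lo hi m λ i → guard (lo′ ≤? m′) (guard (m′ <? hi′) (g i m′)))

  -- Sums over all subsets and binomial coefficients.

  subsetSum : (Subset N → Carrier) → Carrier
  subsetSum {N} = listSum (subsets N)

  subsetSum-suc : (f : Subset (suc N) → Carrier) →
    subsetSum f ≈ subsetSum (f ∘ (outside Vec.∷_)) + subsetSum (f ∘ (inside Vec.∷_))
  subsetSum-suc {N} f = ≈-trans (listSum-++ (map (outside Vec.∷_) (subsets N)) _ f)
    (+-cong (reflexive (listSum-map _ (subsets N) f)) (reflexive (listSum-map _ (subsets N) f)))

  subsetSum-0 : (f : Subset N → Carrier) → (∀ A → f A ≈ 0#) → subsetSum f ≈ 0#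
  subsetSum-0 {N} f e = ≈-trans (listSum-cong (subsets N) e) (listSum-0 (subsets N))

  subsetSum-single : (f : Subset N → Carrier) (A : Subset N) → (∀ B → B ≢ A → f B ≈ 0#) → subsetSum f ≈ f A
  subsetSum-single f Vec.[] e = +-identityʳ _
  subsetSum-single f (outside Vec.∷ A) e = ≈-trans (subsetSum-suc f) (≈-trans
    (+-cong (subsetSum-single (f ∘ (outside Vec.∷_)) A λ B B≢A → e _ λ { refl → B≢A refl })
            (subsetSum-0 (f ∘ (inside Vec.∷_)) λ B → e _ λ ()))
    (+-identityʳ _))
  subsetSum-single f (inside Vec.∷ A) e = ≈-trans (subsetSum-suc f) (≈-trans
    (+-cong (subsetSum-0 (f ∘ (outside Vec.∷_)) λ B → e _ λ ())
            (subsetSum-single (f ∘ (inside Vec.∷_)) A λ B B≢A → e _ λ { refl → B≢A refl }))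
    (+-identityˡ _))

  nC0≡1 : ∀ n → n C 0 ≡ 1
  nC0≡1 n = trans (nCk≡nC[n∸k] {n = n} z≤n) (nCn≡1 n)

  -- Pascal's rule, splitting on membership of the first element.
  subsetSum-size : ∀ n i v → subsetSum {n} (λ A → guard (∣ A ∣ ≟ i) v) ≈ (n C i) · v
  subsetSum-size zero    zero    v = ≈-refl
  subsetSum-size zero    (suc i) v = +-identityˡ 0#
  subsetSum-size (suc n) zero    v = ≈-trans (subsetSum-suc {n} (λ A → guard (∣ A ∣ ≟ 0) v)) (≈-trans
    (+-cong (subsetSum-size n zero v) (subsetSum-0 {n} _ λ _ → ≈-refl))
    (≈-trans (+-identityʳ _) (×-congˡ (trans (nC0≡1 n) (sym (nC0≡1 (suc n)))))))
  subsetSum-size (suc n) (suc i) v = ≈-trans (subsetSum-suc {n} (λ A → guard (∣ A ∣ ≟ suc i) v)) (≈-trans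
    (+-cong (subsetSum-size n (suc i) v) (subsetSum-size n i v))
    (≈-trans (+-comm _ _) (≈-trans (≈-sym (×-homo-+ v (n C i) (n C suc i))) (×-congˡ (nCk+nC[k+1]≡[n+1]C[k+1] n i)))))

  subsetSum-⊆-suc : (E : Subset N) (s : Side) (f : Subset (suc N) → Carrier) →
    subsetSum (λ A → guard (A ⊆? (s Vec.∷ E)) (f A)) ≈
    subsetSum (λ A → guard (A ⊆? E) (f (outside Vec.∷ A))) +
    guard (s Bool.≟ inside) (subsetSum (λ A → guard (A ⊆? E) (f (inside Vec.∷ A))))
  subsetSum-⊆-suc {N} E s f = ≈-trans (subsetSum-suc {N} (λ A → guard (A ⊆? (s Vec.∷ E)) (f A))) (+-cong
    (listSum-cong (subsets N) λ A → reflexive (guard-⇔ ((outside Vec.∷ A) ⊆? (s Vec.∷ E)) (A ⊆? E) drop-∷-⊆ out⊆))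
    (with-element s))
    where
    with-element : ∀ s → subsetSum (λ A → guard ((inside Vec.∷ A) ⊆? (s Vec.∷ E)) (f (inside Vec.∷ A))) ≈
                   guard (s Bool.≟ inside) (subsetSum (λ A → guard (A ⊆? E) (f (inside Vec.∷ A))))
    with-element outside = subsetSum-0 {N}
      (λ A → guard ((inside Vec.∷ A) ⊆? (outside Vec.∷ E)) (f (inside Vec.∷ A))) λ A → reflexive
      (guard-false ((inside Vec.∷ A) ⊆? (outside Vec.∷ E)) {f (inside Vec.∷ A)} λ A⊆ → zero∉ (A⊆ Vec.here))
      where
      zero∉ : Fin.zero ∉ outside Vec.∷ E
      zero∉ ()
    with-element inside  = listSum-cong (subsets N) λ A → reflexive
      (guard-⇔ ((inside Vec.∷ A) ⊆? (inside Vec.∷ E)) (A ⊆? E) {f (inside Vec.∷ A)} drop-∷-⊆ s⊆s)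

  -- The bijection from `A` to the pair `A ∩ F`, `A ─ F`. As the summand sees only sizes, both parts
  -- are re-indexed by full power sets, and recursion on the vectors spares an explicit bijection.
  subsetSum-split : (E F : Subset N) → F ⊆ E → (g : ℕ → ℕ → Carrier) →
    subsetSum (λ A → guard (A ⊆? E) (g ∣ A ∩ F ∣ ∣ A ─ F ∣)) ≈
    subsetSum {∣ F ∣} (λ X → subsetSum {∣ E ─ F ∣} (λ Y → g ∣ X ∣ ∣ Y ∣))
  subsetSum-split Vec.[] Vec.[] F⊆E g = ≈-sym (+-identityʳ _)
  subsetSum-split (outside Vec.∷ E) (inside Vec.∷ F) F⊆E g with () ← F⊆E Vec.here
  subsetSum-split (outside Vec.∷ E) (outside Vec.∷ F) F⊆E g = ≈-trans
    (subsetSum-⊆-suc E outside (λ A → g ∣ A ∩ (outside Vec.∷ F) ∣ ∣ A ─ (outside Vec.∷ F) ∣))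
    (≈-trans (+-identityʳ _) (subsetSum-split E F (drop-∷-⊆ F⊆E) g))
  subsetSum-split (inside Vec.∷ E) (inside Vec.∷ F) F⊆E g = ≈-trans
    (subsetSum-⊆-suc E inside (λ A → g ∣ A ∩ (inside Vec.∷ F) ∣ ∣ A ─ (inside Vec.∷ F) ∣))
    (≈-trans (+-cong (subsetSum-split E F (drop-∷-⊆ F⊆E) g)
                   (subsetSum-split E F (drop-∷-⊆ F⊆E) (λ i j → g (suc i) j)))
    (≈-sym (subsetSum-suc {∣ F ∣} λ X → subsetSum {∣ E ─ F ∣} λ Y → g ∣ X ∣ ∣ Y ∣)))
  subsetSum-split (inside Vec.∷ E) (outside Vec.∷ F) F⊆E g = ≈-trans
    (subsetSum-⊆-suc E inside (λ A → g ∣ A ∩ (outside Vec.∷ F) ∣ ∣ A ─ (outside Vec.∷ F) ∣))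
    (≈-trans (+-cong (subsetSum-split E F (drop-∷-⊆ F⊆E) g)
                   (subsetSum-split E F (drop-∷-⊆ F⊆E) (λ i j → g i (suc j))))
    (≈-trans (≈-sym (listSum-+ (subsets ∣ F ∣) _ _))
    (listSum-cong (subsets ∣ F ∣) λ X → ≈-sym (subsetSum-suc {∣ E ─ F ∣} λ Y → g ∣ X ∣ ∣ Y ∣))))

  listSum-guard : ∀ {p b} {P : Set p} {B : Set b} (d : Dec P) (l : List B) f →
                  guard d (listSum l f) ≈ listSum l (guard d ∘ f)
  listSum-guard d = listSum-homo (guard d) (reflexive (guard-0 d)) (guard-+ d)

  subsetSum-sizes : (E F : Subset N) → F ⊆ E → ∀ i j v →
    subsetSum (λ A → guard (A ⊆? E) (guard (∣ A ∩ F ∣ ≟ i) (guard (∣ A ─ F ∣ ≟ j) v))) ≈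
    (∣ F ∣ C i) · (∣ E ─ F ∣ C j) · v
  subsetSum-sizes E F F⊆E i j v = begin
    subsetSum (λ A → guard (A ⊆? E) (guard (∣ A ∩ F ∣ ≟ i) (guard (∣ A ─ F ∣ ≟ j) v)))
      ≈⟨ subsetSum-split E F F⊆E (λ a b → guard (a ≟ i) (guard (b ≟ j) v)) ⟩
    subsetSum {∣ F ∣} (λ X → subsetSum {∣ E ─ F ∣} (λ Y → guard (∣ X ∣ ≟ i) (guard (∣ Y ∣ ≟ j) v)))
      ≈⟨ listSum-cong (subsets ∣ F ∣) (λ X → ≈-trans (≈-sym (listSum-guard (∣ X ∣ ≟ i) (subsets ∣ E ─ F ∣) _))
           (guard-cong (∣ X ∣ ≟ i) (λ _ → subsetSum-size ∣ E ─ F ∣ j v))) ⟩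
    subsetSum {∣ F ∣} (λ X → guard (∣ X ∣ ≟ i) ((∣ E ─ F ∣ C j) · v))
      ≈⟨ subsetSum-size ∣ F ∣ i _ ⟩
    (∣ F ∣ C i) · (∣ E ─ F ∣ C j) · v ∎

  rangeSum₂-swap : ∀ {b} {B : Set b} lo hi lo′ hi′ (l : List B) (f : ℕ → ℕ → B → Carrier) →
    rangeSum lo hi (λ i → rangeSum lo′ hi′ (λ j → listSum l (f i j))) ≈
    listSum l (λ b → rangeSum lo hi (λ i → rangeSum lo′ hi′ (λ j → f i j b)))
  rangeSum₂-swap lo hi lo′ hi′ l f = ≈-trans
    (rangeSum-cong lo hi λ i → ≈-sym (listSum-sum l {hi′ ∸ lo′} (λ b j → f i (lo′ ℕ.+ toℕ j) b)))
    (≈-sym (listSum-sum l {hi ∸ lo} (λ b i → rangeSum lo′ hi′ (λ j → f (lo ℕ.+ toℕ i) j b))))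

  rangeSum₂-guard : ∀ {p} {P : Set p} (d : Dec P) lo hi lo′ hi′ (f : ℕ → ℕ → Carrier) →
    rangeSum lo hi (λ i → rangeSum lo′ hi′ (λ j → guard d (f i j))) ≈
    guard d (rangeSum lo hi (λ i → rangeSum lo′ hi′ (f i)))
  rangeSum₂-guard d lo hi lo′ hi′ f = ≈-trans
    (rangeSum-cong lo hi λ i → ≈-sym (sum-guard d {hi′ ∸ lo′} λ j → f i (lo′ ℕ.+ toℕ j)))
    (≈-sym (sum-guard d {hi ∸ lo} λ i → rangeSum lo′ hi′ (f (lo ℕ.+ toℕ i))))

  inRange : ∀ lo hi m → Carrier → Carrier
  inRange lo hi m a = guard (lo ≤? m) (guard (m <? hi) a)

  inRange-true : ∀ {lo hi m a} → lo ≤ m → m < hi → inRange lo hi m a ≡ a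
  inRange-true {lo} {hi} {m} l h = trans (guard-true (lo ≤? m) l) (guard-true (m <? hi) h)

  -- Each product of binomials is unfolded into the subsets `A` with trace sizes `i` and `j`. After
  -- exchanging the sums, `A` determines `i` and `j`, and only the range conditions survive.
  binomial-rangeSum : (E F : Subset N) → F ⊆ E → ∀ lo hi lo′ hi′ (g : ℕ → ℕ → Carrier) →
    rangeSum lo hi (λ i → rangeSum lo′ hi′ (λ j → (∣ F ∣ C i) · ((∣ E ∣ ∸ ∣ F ∣) C j) · g i j)) ≈
    subsetSum (λ A → guard (A ⊆? E)
      (inRange lo hi ∣ A ∩ F ∣ (inRange lo′ hi′ ∣ A ─ F ∣ (g ∣ A ∩ F ∣ ∣ A ─ F ∣))))
  binomial-rangeSum {N} E F F⊆E lo hi lo′ hi′ g = begin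
    rangeSum lo hi (λ i → rangeSum lo′ hi′ (λ j → (∣ F ∣ C i) · ((∣ E ∣ ∸ ∣ F ∣) C j) · g i j))
      ≈⟨ rangeSum-cong lo hi (λ i → rangeSum-cong lo′ hi′ (λ j → ≈-trans
           (reflexive (cong (λ m → (∣ F ∣ C i) · (m C j) · g i j) ∣E∣∸∣F∣))
           (≈-sym (subsetSum-sizes E F F⊆E i j (g i j))))) ⟩
    rangeSum lo hi (λ i → rangeSum lo′ hi′ (λ j → subsetSum (λ A → guard (A ⊆? E) (δ A i j))))
      ≈⟨ rangeSum₂-swap lo hi lo′ hi′ (subsets N) (λ i j A → guard (A ⊆? E) (δ A i j)) ⟩
    subsetSum (λ A → rangeSum lo hi (λ i → rangeSum lo′ hi′ (λ j → guard (A ⊆? E) (δ A i j))))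
      ≈⟨ listSum-cong (subsets N) (λ A → ≈-trans (rangeSum₂-guard (A ⊆? E) lo hi lo′ hi′ (δ A))
           (guard-cong (A ⊆? E) λ _ → rangeSum-δ₂ lo hi lo′ hi′ ∣ A ∩ F ∣ ∣ A ─ F ∣ g)) ⟩
    _ ∎
    where
    δ : Subset N → ℕ → ℕ → Carrier
    δ A i j = guard (∣ A ∩ F ∣ ≟ i) (guard (∣ A ─ F ∣ ≟ j) (g i j))
    ∣E∣∸∣F∣ : ∣ E ∣ ∸ ∣ F ∣ ≡ ∣ E ─ F ∣
    ∣E∣∸∣F∣ = trans (cong₂ _∸_ (∣p∣≡∣p∩q∣+∣p─q∣ E F) (cong ∣_∣ (sym (p⊆q⇒q∩p≡p F⊆E)))) (ℕ.m+n∸m≡n ∣ E ∩ F ∣ _)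

  -- Undoes the grouping by rank and size. Every `F` inside the ground set has its rank and size
  -- within the ranges, because the excluded upper bounds are one more than `rank M` and `size M`.
  stressedSum : (M : Matroid N) (g : ℕ → ℕ → Carrier) →
    rangeSum 0 (suc (rank M)) (λ r → rangeSum 0 (suc (size M)) (λ h → stressedCount M r h · g r h)) ≈
    subsetSum (λ F → guard (stressed? M F) (guard (nonemptyCover? M F) (g (rk M F) ∣ F ∣)))
  stressedSum {N} M g = begin
    rangeSum 0 k (λ r → rangeSum 0 n (λ h → stressedCount M r h · g r h))
      ≈⟨ rangeSum-cong 0 k (λ r → rangeSum-cong 0 n (λ h → ≈-trans
           (length-filter-·
             (λ F → stressed? M F ×-dec nonemptyCover? M F ×-dec (rk M F ≟ r) ×-dec (∣ F ∣ ≟ h)) (subsets N) (g r h))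
           (listSum-cong (subsets N) λ F → reflexive (nested-guards F r h)))) ⟩
    rangeSum 0 k (λ r → rangeSum 0 n (λ h → subsetSum (λ F → Q F (δ F r h))))
      ≈⟨ rangeSum₂-swap 0 k 0 n (subsets N) (λ r h F → Q F (δ F r h)) ⟩
    subsetSum (λ F → rangeSum 0 k (λ r → rangeSum 0 n (λ h → Q F (δ F r h))))
      ≈⟨ listSum-cong (subsets N) (λ F → ≈-trans
           (rangeSum₂-guard (stressed? M F) 0 k 0 n (λ r h → guard (nonemptyCover? M F) (δ F r h)))
           (guard-cong (stressed? M F) λ st → ≈-trans (rangeSum₂-guard (nonemptyCover? M F) 0 k 0 n (δ F))
           (guard-cong (nonemptyCover? M F) λ _ → ≈-trans (rangeSum-δ₂ 0 k 0 n (rk M F) ∣ F ∣ g)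
           (reflexive (trans (inRange-true z≤n (s≤s (rk-monotone M (proj₁ st) id)))
                               (inRange-true z≤n (s≤s (p⊆q⇒∣p∣≤∣q∣ (proj₁ st))))))))) ⟩
    _ ∎
    where
    k = suc (rank M)
    n = suc (size M)
    Q : Subset N → Carrier → Carrier
    Q F a = guard (stressed? M F) (guard (nonemptyCover? M F) a)
    δ : Subset N → ℕ → ℕ → Carrier
    δ F r h = guard (rk M F ≟ r) (guard (∣ F ∣ ≟ h) (g r h))
    nested-guards : ∀ F r h →
      guard (stressed? M F ×-dec nonemptyCover? M F ×-dec (rk M F ≟ r) ×-dec (∣ F ∣ ≟ h)) (g r h) ≡ Q F (δ F r h)
    nested-guards F r h = let at-h = ∣ F ∣ ≟ h; at-r = rk M F ≟ r; cov = nonemptyCover? M F in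
      trans (guard-× (stressed? M F) (cov ×-dec at-r ×-dec at-h) (g r h)) (cong (guard (stressed? M F))
      (trans (guard-× cov (at-r ×-dec at-h) (g r h)) (cong (guard cov) (guard-× at-r at-h (g r h)))))

  -- Tutte terms and their difference.

  X Y : Carrier
  X = x - 1#
  Y = y - 1#

  tutteTerm : (k r a : ℕ) → Carrier
  tutteTerm k r a = X ^ (k ∸ r) * Y ^ (a ∸ r)

  T≈subsetSum : (M : Matroid N) → T M ≈ subsetSum (λ A → guard (A ⊆? ground M) (tutteTerm (rank M) (rk M A) ∣ A ∣))
  T≈subsetSum {N} M = listSum-filter (_⊆? ground M) (subsets N) _

  -- `U` lives on all of `Fin ∣ E ∣`, whereas `E` sits in a larger ambient set. The terms depend on
  -- sizes only, so `subsetSum-split` transports one sum to the other.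
  T-uniform : (k : ℕ) (E : Subset N) (k≤ : k ≤ ∣ E ∣) →
    T (U k ∣ E ∣ k≤) ≈ subsetSum (λ A → guard (A ⊆? E) (tutteTerm k (∣ A ∣ ⊓ k) ∣ A ∣))
  T-uniform {N} k E k≤ = begin
    T (U k ∣ E ∣ k≤)
      ≈⟨ T≈subsetSum (U k ∣ E ∣ k≤) ⟩
    subsetSum {∣ E ∣} (λ A → guard (A ⊆? ⊤) (tutteTerm (rank (U k ∣ E ∣ k≤)) (∣ A ∣ ⊓ k) ∣ A ∣))
      ≈⟨ listSum-cong (subsets ∣ E ∣) (λ A → reflexive (trans (guard-true (A ⊆? ⊤) ⊆⊤)
           (cong (λ k′ → tutteTerm k′ (∣ A ∣ ⊓ k) ∣ A ∣) (ℕ.m≥n⇒m⊓n≡n (subst (k ≤_) (sym (∣⊤∣≡n ∣ E ∣)) k≤))))) ⟩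
    subsetSum {∣ E ∣} (λ A → u ∣ A ∣)
      -- A one-term sum over the subsets of the empty set is inserted to match `subsetSum-split`
      -- with `F` taken to be `⊥`.
      ≈⟨ +-identityʳ _ ⟨
    subsetSum {0} (λ _ → subsetSum {∣ E ∣} (λ A → u ∣ A ∣))
      ≡⟨ cong₂ (λ a b → subsetSum {a} (λ Z → subsetSum {b} (λ A → u (∣ Z ∣ ℕ.+ ∣ A ∣)))) (∣⊥∣≡0 N) (cong ∣_∣ (p─⊥≡p E)) ⟨
    subsetSum {∣ ⊥ {N} ∣} (λ Z → subsetSum {∣ E ─ ⊥ ∣} (λ A → u (∣ Z ∣ ℕ.+ ∣ A ∣)))
      ≈⟨ subsetSum-split E ⊥ ⊥⊆ (λ i j → u (i ℕ.+ j)) ⟨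
    subsetSum (λ A → guard (A ⊆? E) (u (∣ A ∩ ⊥ ∣ ℕ.+ ∣ A ─ ⊥ ∣)))
      ≈⟨ listSum-cong (subsets N) (λ A → reflexive (cong (λ a → guard (A ⊆? E) (u a)) (sym (∣p∣≡∣p∩q∣+∣p─q∣ A ⊥)))) ⟩
    subsetSum (λ A → guard (A ⊆? E) (u ∣ A ∣)) ∎
    where
    u : ℕ → Carrier
    u a = tutteTerm k (a ⊓ k) a

  -- In both cases α is c * (1# - z), where c is the term of A in T_U and c * z its term in T_M.
  complement : ∀ c z → c * z + c * (1# - z) ≈ c
  complement c z = begin
    c * z + c * (1# - z)   ≈⟨ distribˡ c z (1# - z) ⟨
    c * (z + (1# - z))     ≈⟨ *-congˡ (≈-trans (+-comm z _)
                             (≈-trans (+-assoc 1# (- z) z) (≈-trans (+-congˡ (-‿inverseˡ z)) (+-identityʳ 1#)))) ⟩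
    c * 1#                 ≈⟨ *-identityʳ c ⟩
    c                      ∎

  α-≤ : ∀ r k i j → i ℕ.+ j ≤ k → α r k i j ≡ X ^ (k ∸ i ∸ j) * (1# - (X * Y) ^ (i ∸ r))
  α-≤ r k i j le = cong
    (if_then X ^ (k ∸ i ∸ j) * (1# - (X * Y) ^ (i ∸ r))
     else Y ^ (i ℕ.+ j ∸ k) * (1# - (X * Y) ^ (k ∸ r ∸ j))) (dec-true (i ℕ.+ j ≤? k) le)

  α-> : ∀ r k i j → k < i ℕ.+ j → α r k i j ≡ Y ^ (i ℕ.+ j ∸ k) * (1# - (X * Y) ^ (k ∸ r ∸ j))
  α-> r k i j gt = cong
    (if_then X ^ (k ∸ i ∸ j) * (1# - (X * Y) ^ (i ∸ r))
     else Y ^ (i ℕ.+ j ∸ k) * (1# - (X * Y) ^ (k ∸ r ∸ j))) (dec-false (i ℕ.+ j ≤? k) (ℕ.<⇒≱ gt))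

  ∸-telescope : ∀ {a b c} → c ≤ b → b ≤ a → a ∸ c ≡ (a ∸ b) ℕ.+ (b ∸ c)
  ∸-telescope {a} {b} {c} c≤b b≤a = trans (cong (_∸ c) (sym (ℕ.m∸n+n≡m b≤a))) (ℕ.+-∸-assoc (a ∸ b) c≤b)

  -- In both cases the exponent `d` of `X * Y` is the rank drop, namely `(i ℕ.+ j) ⊓ k` less
  -- `r ℕ.+ j`. Lowering the rank by `d` raises both exponents of a Tutte term by `d`.
  tutteTerm+α : ∀ {r k i j} → r < i → j < k ∸ r →
                tutteTerm k (r ℕ.+ j) (i ℕ.+ j) + α r k i j ≈ tutteTerm k ((i ℕ.+ j) ⊓ k) (i ℕ.+ j)
  tutteTerm+α {r} {k} {i} {j} r<i j<k∸r with ℕ.≤-<-connex (i ℕ.+ j) k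
  ... | inj₁ i+j≤k = begin
    X ^ (k ∸ (r ℕ.+ j)) * Y ^ (i ℕ.+ j ∸ (r ℕ.+ j)) + α r k i j
      ≡⟨ cong₂ _+_ (cong₂ (λ a b → X ^ a * Y ^ b) exponentX exponentY)
           (α-≤ r k i j i+j≤k) ⟩
    X ^ (a ℕ.+ d) * Y ^ d + X ^ a * (1# - (X * Y) ^ d)
      ≈⟨ +-congʳ (≈-trans (*-congʳ (^-homo-* X a d)) (≈-trans (*-assoc _ _ _) (*-congˡ (≈-sym (^-distrib-* X Y d))))) ⟩
    X ^ a * (X * Y) ^ d + X ^ a * (1# - (X * Y) ^ d)
      ≈⟨ complement (X ^ a) ((X * Y) ^ d) ⟩
    X ^ a
      ≈⟨ *-identityʳ _ ⟨
    X ^ a * Y ^ 0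
      ≡⟨ cong₂ (λ a b → X ^ a * Y ^ b) (trans (ℕ.∸-+-assoc k i j) (cong (k ∸_) (sym i+j⊓k)))
           (trans (sym (ℕ.n∸n≡0 (i ℕ.+ j))) (cong (i ℕ.+ j ∸_) (sym i+j⊓k))) ⟩
    tutteTerm k ((i ℕ.+ j) ⊓ k) (i ℕ.+ j) ∎
    where
    a = k ∸ i ∸ j
    d = i ∸ r
    i+j⊓k : (i ℕ.+ j) ⊓ k ≡ i ℕ.+ j
    i+j⊓k = ℕ.m≤n⇒m⊓n≡m i+j≤k
    exponentY : i ℕ.+ j ∸ (r ℕ.+ j) ≡ d
    exponentY = trans (cong₂ _∸_ (ℕ.+-comm i j) (ℕ.+-comm r j)) (ℕ.[m+n]∸[m+o]≡n∸o j i r)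
    exponentX : k ∸ (r ℕ.+ j) ≡ a ℕ.+ d
    exponentX = trans (∸-telescope (ℕ.+-monoˡ-≤ j (ℕ.<⇒≤ r<i)) i+j≤k)
      (cong₂ ℕ._+_ (sym (ℕ.∸-+-assoc k i j)) exponentY)
  ... | inj₂ k<i+j = begin
    X ^ (k ∸ (r ℕ.+ j)) * Y ^ (i ℕ.+ j ∸ (r ℕ.+ j)) + α r k i j
      ≡⟨ cong₂ _+_ (cong₂ (λ a b → X ^ a * Y ^ b) (sym (ℕ.∸-+-assoc k r j)) exponentY)
           (α-> r k i j k<i+j) ⟩
    X ^ d * Y ^ (b ℕ.+ d) + Y ^ b * (1# - (X * Y) ^ d)
      ≈⟨ +-congʳ (≈-trans (*-congˡ (^-homo-* Y b d)) (≈-trans (≈-sym (*-assoc _ _ _)) (≈-trans (*-congʳ (*-comm _ _))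
           (≈-trans (*-assoc _ _ _) (*-congˡ (≈-sym (^-distrib-* X Y d))))))) ⟩
    Y ^ b * (X * Y) ^ d + Y ^ b * (1# - (X * Y) ^ d)
      ≈⟨ complement (Y ^ b) ((X * Y) ^ d) ⟩
    Y ^ b
      ≈⟨ *-identityˡ _ ⟨
    X ^ 0 * Y ^ b
      ≡⟨ cong₂ (λ a b → X ^ a * Y ^ b) (trans (sym (ℕ.n∸n≡0 k)) (cong (k ∸_) (sym i+j⊓k)))
           (cong (i ℕ.+ j ∸_) (sym i+j⊓k)) ⟩
    tutteTerm k ((i ℕ.+ j) ⊓ k) (i ℕ.+ j) ∎
    where
    b = i ℕ.+ j ∸ k
    d = k ∸ r ∸ j
    r≤k : r ≤ k
    r≤k = ℕ.<⇒≤ (ℕ.m∸n≢0⇒n<m {k} {r} (ℕ.>⇒≢ (ℕ.≤-<-trans z≤n j<k∸r)))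
    r+j≤k : r ℕ.+ j ≤ k
    r+j≤k = ℕ.≤-trans (ℕ.+-monoʳ-≤ r (ℕ.<⇒≤ j<k∸r)) (ℕ.≤-reflexive (ℕ.m+[n∸m]≡n r≤k))
    i+j⊓k : (i ℕ.+ j) ⊓ k ≡ k
    i+j⊓k = ℕ.m≥n⇒m⊓n≡n (ℕ.<⇒≤ k<i+j)
    exponentY : i ℕ.+ j ∸ (r ℕ.+ j) ≡ b ℕ.+ d
    exponentY = trans (∸-telescope r+j≤k (ℕ.<⇒≤ k<i+j)) (cong (b ℕ.+_) (sym (ℕ.∸-+-assoc k r j)))


  -- The formula, compared subset by subset.

  module _ (M : Matroid N) (es : ElementarySplit M) where

    k n : ℕ
    k = rank M
    n = size M

    coverSum : (r h : ℕ) → Carrier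
    coverSum r h = ∑[ suc r ≤ i < suc h ] ∑[ 0 ≤ j < k ∸ r ] ((h C i) · ((n ∸ h) C j) · α r k i j)

    correction : Carrier
    correction = ∑[ 0 ≤ r < suc k ] ∑[ 0 ≤ h < suc n ] (stressedCount M r h · coverSum r h)

    -- The guards keep the shape that the summations over `F`, `i` and `j` produce. For `A` in the
    -- ground set they hold together exactly when `Drops M A F` does.
    contribution : Subset N → Subset N → Carrier
    contribution A F = guard (stressed? M F) (guard (nonemptyCover? M F)
      (inRange (suc (rk M F)) (suc ∣ F ∣) ∣ A ∩ F ∣ (inRange 0 (k ∸ rk M F) ∣ A ─ F ∣
        (α (rk M F) k ∣ A ∩ F ∣ ∣ A ─ F ∣))))

    -- Exchanges the outer sum over `F` with the sum over `A`, so that uniqueness of `F` can be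
    -- applied to each `A` separately.
    correction≈ : correction ≈ subsetSum (λ A → guard (A ⊆? ground M) (subsetSum (contribution A)))
    correction≈ = begin
      correction
        ≈⟨ stressedSum M coverSum ⟩
      subsetSum (λ F → guard (stressed? M F) (guard (nonemptyCover? M F)
        (coverSum (rk M F) ∣ F ∣)))
        ≈⟨ listSum-cong (subsets N) (λ F → ≈-trans
             (guard-cong (stressed? M F) λ st → ≈-trans
               (guard-cong (nonemptyCover? M F) λ _ →
                 binomial-rangeSum (ground M) F (proj₁ st) (suc (rk M F)) (suc ∣ F ∣) 0 (k ∸ rk M F) (α (rk M F) k))
               (listSum-guard (nonemptyCover? M F) (subsets N) _))
             (listSum-guard (stressed? M F) (subsets N) _)) ⟩
      subsetSum (λ F → subsetSum (λ A → guard (stressed? M F) (guard (nonemptyCover? M F) (guard (A ⊆? ground M) _))))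
        ≈⟨ listSum-swap (subsets N) (subsets N) _ ⟩
      subsetSum (λ A → subsetSum (λ F → guard (stressed? M F) (guard (nonemptyCover? M F) (guard (A ⊆? ground M) _))))
        ≈⟨ listSum-cong (subsets N) (λ A → ≈-trans
             (listSum-cong (subsets N) λ F → reflexive (guard-comm₂ (stressed? M F) (nonemptyCover? M F) (A ⊆? ground M)))
             (≈-sym (listSum-guard (A ⊆? ground M) (subsets N) (contribution A)))) ⟩
      subsetSum (λ A → guard (A ⊆? ground M) (subsetSum (contribution A))) ∎
      where
      guard-comm₂ : ∀ {p q s} {P : Set p} {Q : Set q} {S : Set s} (d : Dec P) (d′ : Dec Q) (d″ : Dec S) {a} →
        guard d (guard d′ (guard d″ a)) ≡ guard d″ (guard d (guard d′ a))
      guard-comm₂ (yes _) (yes _) d″ = refl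
      guard-comm₂ (yes _) (no _)  d″ = sym (guard-0 d″)
      guard-comm₂ (no _)  d′      d″ = sym (guard-0 d″)

    contribution-drops : ∀ {A F} → A ⊆ ground M → Drops M A F → contribution A F ≡ α (rk M F) k ∣ A ∩ F ∣ ∣ A ─ F ∣
    contribution-drops {A} {F} A⊆E d@(st , i , j) = trans (guard-true (stressed? M F) st)
      (trans (guard-true (nonemptyCover? M F) (drops⇒nonemptyCover M A⊆E d))
      (trans (inRange-true i (s≤s (∣p∩q∣≤∣q∣ A F))) (inRange-true z≤n j)))

    contribution-¬drops : ∀ A F → ¬ Drops M A F → contribution A F ≈ 0#
    contribution-¬drops A F ¬d =
      guard-≈0 (stressed? M F) λ st → guard-≈0 (nonemptyCover? M F) λ _ →
      guard-≈0 (suc (rk M F) ≤? ∣ A ∩ F ∣) λ i → guard-≈0 (∣ A ∩ F ∣ <? suc ∣ F ∣) λ _ →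
      guard-≈0 (0 ≤? ∣ A ─ F ∣) λ _ → guard-≈0 (∣ A ─ F ∣ <? k ∸ rk M F) λ j → absurd (¬d (st , i , j))

    pointwise : ∀ {A} → A ⊆ ground M →
      tutteTerm k (rk M A) ∣ A ∣ + subsetSum (contribution A) ≈ tutteTerm k (∣ A ∣ ⊓ k) ∣ A ∣
    pointwise {A} A⊆E with anySubset? (drops? M A)
    ... | no none = begin
      tutteTerm k (rk M A) ∣ A ∣ + subsetSum (contribution A)
        ≈⟨ +-congˡ (subsetSum-0 (contribution A) λ F → contribution-¬drops A F λ d → none (F , d)) ⟩
      tutteTerm k (rk M A) ∣ A ∣ + 0#
        ≈⟨ +-identityʳ _ ⟩
      tutteTerm k (rk M A) ∣ A ∣
        ≡⟨ cong (λ r → tutteTerm k r ∣ A ∣) (no-drop⇒uniform-rk M es A⊆E none) ⟩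
      tutteTerm k (∣ A ∣ ⊓ k) ∣ A ∣ ∎
    ... | yes (F , d@(st , r<i , j<k∸r)) = begin
      tutteTerm k (rk M A) ∣ A ∣ + subsetSum (contribution A)
        ≈⟨ +-congˡ (subsetSum-single (contribution A) F λ F′ F′≢F →
             contribution-¬drops A F′ λ d′ → F′≢F (drops-unique M A⊆E d′ d)) ⟩
      tutteTerm k (rk M A) ∣ A ∣ + contribution A F
        ≡⟨ cong₂ _+_ (cong₂ (tutteTerm k) (drops-rk M A⊆E d) ∣A∣) (contribution-drops A⊆E d) ⟩
      tutteTerm k (rk M F ℕ.+ j) (i ℕ.+ j) + α (rk M F) k i j
        ≈⟨ tutteTerm+α r<i j<k∸r ⟩
      tutteTerm k ((i ℕ.+ j) ⊓ k) (i ℕ.+ j)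
        ≡⟨ cong (λ a → tutteTerm k (a ⊓ k) a) ∣A∣ ⟨
      tutteTerm k (∣ A ∣ ⊓ k) ∣ A ∣ ∎
      where
      i = ∣ A ∩ F ∣
      j = ∣ A ─ F ∣
      ∣A∣ : ∣ A ∣ ≡ i ℕ.+ j
      ∣A∣ = ∣p∣≡∣p∩q∣+∣p─q∣ A F

    -- The termwise comparison is additive, with the correction added to `T M`; subtraction enters
    -- only through this final cancellation.
    tutte-formula : T M ≈ T (U k n (rank≤size M)) - correction
    tutte-formula = begin
      T M                                   ≈⟨ +-identityʳ _ ⟨
      T M + 0#                              ≈⟨ +-congˡ (-‿inverseʳ correction) ⟨
      T M + (correction - correction)       ≈⟨ +-assoc _ _ _ ⟨
      (T M + correction) - correction       ≈⟨ +-congʳ (begin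
        T M + correction
          ≈⟨ +-cong (T≈subsetSum M) correction≈ ⟩
        subsetSum (λ A → guard (A ⊆? ground M) (tutteTerm k (rk M A) ∣ A ∣)) +
        subsetSum (λ A → guard (A ⊆? ground M) (subsetSum (contribution A)))
          ≈⟨ listSum-+ (subsets N) _ _ ⟨
        subsetSum (λ A → guard (A ⊆? ground M) (tutteTerm k (rk M A) ∣ A ∣) +
                         guard (A ⊆? ground M) (subsetSum (contribution A)))
          ≈⟨ listSum-cong (subsets N) (λ A → ≈-trans (≈-sym (guard-+ (A ⊆? ground M) _ _)) (guard-cong (A ⊆? ground M) pointwise)) ⟩
        subsetSum (λ A → guard (A ⊆? ground M) (tutteTerm k (∣ A ∣ ⊓ k) ∣ A ∣))
          ≈⟨ T-uniform k (ground M) (rank≤size M) ⟨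
        T (U k n (rank≤size M)) ∎) ⟩
      T (U k n (rank≤size M)) - correction  ∎

open CommutativeRing ℤ[x,y] using (_≈_; _-_)
open Tutte ℤ[x,y] x y

theorem7p20 : ∀ {N} (M : Matroid N) → ElementarySplit M →
    let k = Matroid.rank M
        n = Matroid.size M
    in
    T M ≈ T (U k n (Matroid.rank≤size M)) -
      (∑[ 0 ≤ r < suc k ] ∑[ 0 ≤ h < suc n ] (stressedCount M r h ·
        (∑[ suc r ≤ i < suc h ] ∑[ 0 ≤ j < k ∸ r ] ((h C i) · ((n ∸ h) C j) · α r k i j))))
theorem7p20 = TutteExpansion.tutte-formula ℤ[x,y] x y
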